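{- Let $K$ be a field and let $G$ be a finite simple graph without isolated vertices with $|E_G|>1$. Let $\prec$ be a grevlex order on $K[E_G]$. Let $\mathscr{E}$ be the set of Eulerian binomials of $K[E_G]$, let $\mathscr{T}=\{t_h^2-t_\ell^2 : h,\ell\in E_G\}$, and let $\mathscr{G}=\mathscr{T}\cup\mathscr{E}$. Then $\mathscr{G}$ is a Gröbner basis of the Eulerian ideal $I(X_G)$ with respect to $\prec$.
   Context: $G$ has vertex set $V_G$ and edge set $E_G$, a non-empty set of $2$-element subsets of $V_G$. Put $K[V_G]=K[x_i : i\in V_G]$ and $K[E_G]=K[t_h : h\in E_G]$. Let $\varphi\colon K[E_G]\to K[V_G]$ be the $K$-algebra homomorphism with $\varphi(t_h)=x_ix_j$ for $h=\{i,j\}\in E_G$. The Eulerian ideal of $G$ is $I(X_G)=\varphi^{ -1}\big((x_i^2-x_j^2 : i,j\in V_G)\big)\subset K[E_G]$. For $\alpha\colon E_G\to\mathbb{N}$, write $\mathbf{t}^\alpha=\prod_{h\in E_G}t_h^{\alpha(h)}$ and $\mathcal{J}(\mathbf{t}^\alpha)=\{h\in E_G : \alpha(h)\text{ is odd}\}$. A set of edges defines the subgraph edge-induced by it. A subgraph of $G$ is called even Eulerian if all its vertices have even degree in the subgraph and its edge set has even cardinality (it need be neither connected nor spanning). A binomial $\mathbf{t}^\alpha-\mathbf{t}^\beta$ is called Eulerian if $\mathbf{t}^\alpha$ and $\mathbf{t}^\beta$ are distinct, relatively prime, square-free monomials of the same degree and the subgraph edge-induced by $\mathcal{J}(\mathbf{t}^\alpha)\cup\mathcal{J}(\mathbf{t}^\beta)$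 is an even Eulerian subgraph of $G$. A grevlex order on $K[E_G]$ is the graded reverse lexicographic order induced by $t_{\epsilon(1)}\succ t_{\epsilon(2)}\succ\cdots\succ t_{\epsilon(s)}$, where $s=|E_G|$ and $\epsilon\colon\{1,\dots,s\}\to E_G$ is a bijection. (The zero polynomial, obtained in $\mathscr{T}$ when $h=\ell$, plays no role in the Gröbner basis.) -}

module Defs where

open import Algebra.Apartness.Bundles using (HeytingField)
open import Algebra.Bundles.Raw using (RawSemiring)
import Algebra.Definitions.RawSemiring as RawSemiringOps
open import Data.Bool.Base using (if_then_else_)
open import Data.Fin.Base using (Fin) renaming (_<_ to _<ᶠ_)
open import Data.Fin.Permutation using (Permutation′; _⟨$⟩ʳ_)
open import Data.Fin.Subset using (Subset; ⁅_⁆; _∪_; _∩_; ∣_∣; _∈_)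
open import Data.List.Base using (List; []; _∷_; _++_; foldr; map; cartesianProductWith)
open import Data.List.Relation.Unary.Any using (Any)
open import Data.Nat.Base using (ℕ; _+_; _≤_; _<_)
open import Data.Nat.Divisibility using (_∣_; _∣?_)
import Data.Nat.Properties as ℕ
open import Data.Product using (Σ-syntax; ∃-syntax; ∃₂; _×_; _,_; proj₁; proj₂)
open import Data.Sum.Base using (_⊎_)
open import Data.Vec.Base using (Vec; lookup; replicate; sum; tabulate; zipWith; _[_]≔_)
open import Data.Vec.Properties using (≡-dec)
open import Function.Bundles using (_⇔_)
open import Function.Definitions using (Injective)
open import Level using (_⊔_)
open import Relation.Binary.Core using (Rel)
open import Relation.Binary.PropositionalEquality using (_≡_; _≢_)
open import Relation.Nullary.Decidable using (does; ¬?)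
open import Relation.Unary using (Pred; _⊆_; _≐_; _⊢_)

Monomial : ℕ → Set
Monomial n = Vec ℕ n

degree : ∀ {n} → Monomial n → ℕ
degree = sum

_·_ : ∀ {n} → Monomial n → Monomial n → Monomial n
_·_ = zipWith _+_

-- Grevlex ε α β  means  α ≺ β,  the variables being ordered  ε 0 ≻ ε 1 ≻ ⋯ .
-- In equal degree, k is the last (smallest) variable at which α and β
-- differ, and the monomial with the larger exponent there is the smaller.
Grevlex : ∀ {n} → Permutation′ n → Rel (Monomial n) _
Grevlex {n} ε α β =
  degree α < degree β ⊎
  (degree α ≡ degree β ×
   Σ[ k ∈ Fin n ]
     (lookup β (ε ⟨$⟩ʳ k) < lookup α (ε ⟨$⟩ʳ k) ×
      (∀ j → k <ᶠ j → lookup α (ε ⟨$⟩ʳ j) ≡ lookup β (ε ⟨$⟩ʳ j))))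

-- Classically a Heyting field is exactly a
-- field, with  x # y  meaning  x ≠ y.

module Polynomials {c ℓ₁ ℓ₂} (K : HeytingField c ℓ₁ ℓ₂) where

  private module K = HeytingField K

  -- A polynomial is a formal sum of terms; monomials may be repeated, and
  -- terms may be zero, so equality of polynomials is _≈_ and not _≡_.
  Poly : ℕ → Set c
  Poly n = List (K.Carrier × Monomial n)

  coeff : ∀ {n} → Poly n → Monomial n → K.Carrier
  coeff f m =
    foldr (λ (a , m′) s → if does (≡-dec ℕ._≟_ m′ m) then a K.+ s else s) K.0# f

  infix 4 _≈_
  _≈_ : ∀ {n} → Rel (Poly n) ℓ₁
  f ≈ g = ∀ m → coeff f m K.≈ coeff g m

  infixl 6 _⊕_ _⊖_
  infixl 7 _⊗_

  const : ∀ {n} → K.Carrier → Poly n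
  const a = (a , replicate _ 0) ∷ []

  monomial : ∀ {n} → Monomial n → Poly n
  monomial m = (K.1# , m) ∷ []

  var : ∀ {n} → Fin n → Poly n
  var i = monomial (replicate _ 0 [ i ]≔ 1)

  _⊕_ _⊖_ _⊗_ : ∀ {n} → Poly n → Poly n → Poly n
  f ⊕ g = f ++ g
  f ⊖ g = f ++ map (λ (a , m) → K.- a , m) g
  f ⊗ g = cartesianProductWith (λ (a , m) (b , m′) → a K.* b , m · m′) f g

  rawSemiring : ℕ → RawSemiring c ℓ₁
  rawSemiring n = record
    { Carrier = Poly n
    ; _≈_     = _≈_
    ; _+_     = _⊕_
    ; _*_     = _⊗_
    ; 0#      = []
    ; 1#      = const K.1#
    }

  module _ {n : ℕ} where
    open RawSemiringOps (rawSemiring n) public using (_^_; product)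

  -- The K-algebra homomorphism sending the i-th variable to σ i.
  substitute : ∀ {m n} → (Fin m → Poly n) → Poly m → Poly n
  substitute σ =
    foldr (λ (a , α) g → const a ⊗ product (λ i → σ i ^ lookup α i) ⊕ g) []

  -- The ideal generated by a set of polynomials.
  data ⟨_⟩ {n ℓ} (S : Pred (Poly n) ℓ) : Pred (Poly n) (c ⊔ ℓ₁ ⊔ ℓ) where
    generator : ∀ {f} → S f → ⟨ S ⟩ f
    zero      : ⟨ S ⟩ []
    add       : ∀ {f g} → ⟨ S ⟩ f → ⟨ S ⟩ g → ⟨ S ⟩ (f ⊕ g)
    multiply  : ∀ f {g} → ⟨ S ⟩ g → ⟨ S ⟩ (f ⊗ g)
    respects  : ∀ {f g} → f ≈ g → ⟨ S ⟩ f → ⟨ S ⟩ g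

  module _ {n ℓ} (_≺_ : Rel (Monomial n) ℓ) where

    -- m is the leading monomial of f; the zero polynomial has none.
    IsLeadingMonomial : Poly n → Monomial n → Set _
    IsLeadingMonomial f m =
      coeff f m K.# K.0# ×
      (∀ m′ → coeff f m′ K.# K.0# → m′ ≡ m ⊎ m′ ≺ m)

    LeadingMonomials : ∀ {ℓ′} → Pred (Poly n) ℓ′ → Pred (Poly n) _
    LeadingMonomials S g = ∃₂ λ f m → S f × IsLeadingMonomial f m × g ≈ monomial m

    InitialIdeal : ∀ {ℓ′} → Pred (Poly n) ℓ′ → Pred (Poly n) _
    InitialIdeal S = ⟨ LeadingMonomials S ⟩

    record IsGröbnerBasis {ℓ′ ℓ″} (I : Pred (Poly n) ℓ′) (B : Pred (Poly n) ℓ″)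
                          : Set (c ⊔ ℓ₁ ⊔ ℓ₂ ⊔ ℓ ⊔ ℓ′ ⊔ ℓ″) where
      field
        finite  : ∃[ fs ] (∀ f → B f ⇔ Any (f ≈_) fs)
        subset  : B ⊆ I
        initial : InitialIdeal B ≐ InitialIdeal I

-- The vertex set is Fin order and the edges are indexed, without
-- repetition, by Fin size.  A 2-element set of vertices is given by its
-- two elements in increasing order.
record Graph : Set where
  field
    order          : ℕ
    size           : ℕ
    ends           : Fin size → Fin order × Fin order
    ends-ordered   : ∀ h → proj₁ (ends h) <ᶠ proj₂ (ends h)
    ends-injective : Injective _≡_ _≡_ ends

  edge : Fin size → Subset order
  edge h = ⁅ proj₁ (ends h) ⁆ ∪ ⁅ proj₂ (ends h) ⁆

  NoIsolatedVertices : Set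
  NoIsolatedVertices = ∀ v → ∃[ h ] v ∈ edge h

  incident : Fin order → Subset size
  incident v = tabulate (λ h → lookup (edge h) v)

  -- A set J of edges stands for the subgraph edge-induced by it.
  IsVertexOf : Subset size → Fin order → Set
  IsVertexOf J v = ∃[ h ] (h ∈ J × v ∈ edge h)

  degreeIn : Subset size → Fin order → ℕ
  degreeIn J v = ∣ J ∩ incident v ∣

  EvenEulerian : Subset size → Set
  EvenEulerian J = (∀ v → IsVertexOf J v → 2 ∣ degreeIn J v) × 2 ∣ ∣ J ∣

module Eulerian {c ℓ₁ ℓ₂} (K : HeytingField c ℓ₁ ℓ₂) (G : Graph) where

  open Polynomials K
  open Graph G

  φ : Poly size → Poly order
  φ = substitute (λ h → var (proj₁ (ends h)) ⊗ var (proj₂ (ends h)))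

  EulerianIdeal : Pred (Poly size) _
  EulerianIdeal = φ ⊢ ⟨ (λ f → ∃₂ λ i j → f ≈ var i ^ 2 ⊖ var j ^ 2) ⟩

  oddEdges : Monomial size → Subset size
  oddEdges α = tabulate (λ h → does (¬? (2 ∣? lookup α h)))

  SquareFree : Monomial size → Set
  SquareFree α = ∀ h → lookup α h ≤ 1

  RelativelyPrime : Monomial size → Monomial size → Set
  RelativelyPrime α β = ∀ h → lookup α h ≡ 0 ⊎ lookup β h ≡ 0

  record IsEulerianPair (α β : Monomial size) : Set where
    field
      distinct        : α ≢ β
      relativelyPrime : RelativelyPrime α β
      squareFreeˡ     : SquareFree α
      squareFreeʳ     : SquareFree β
      sameDegree      : degree α ≡ degree β
      evenEulerian    : EvenEulerian (oddEdges α ∪ oddEdges β)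

  𝓔 : Pred (Poly size) _
  𝓔 f = ∃₂ λ α β → IsEulerianPair α β × f ≈ monomial α ⊖ monomial β

  -- Contains the zero polynomial (h ≡ l), which has no leading monomial.
  𝓣 : Pred (Poly size) _
  𝓣 f = ∃₂ λ h l → f ≈ var h ^ 2 ⊖ var l ^ 2

-- Modulo J = (xᵢ² - xⱼ²) two monomials of K[V] are equal when they have the same degree and the
-- same exponents mod 2, and a functional on K[V] that is constant on such classes kills J. Hence
-- tᵅ - tᵝ lies in the Eulerian ideal when φ(tᵅ) and φ(tᵝ) are in the same class, and the
-- coefficients of an f in the ideal sum to zero over each class, so a leading monomial m of f comes
-- with a smaller m′ of the same class. Let s be the smallest variable. If some h ≠ s has exponent at
-- least 2 in m, then t_h² - t_s² has a leading monomial dividing m. Otherwise the set D of edges at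
-- which m and m′ differ in parity is even Eulerian, and, as m′ ≺ m have the same degree, at least
-- half of D consists of edges of odd exponent in m other than s and the smallest element of D.
-- Half of D chosen among them, against the rest of D, is an Eulerian binomial whose leading
-- monomial divides m.

module Submission where

open import Defs
open import Algebra.Apartness.Bundles using (HeytingField; module HeytingCommutativeRing)
import Algebra.Apartness.Properties.HeytingCommutativeRing as HeytingProperties
open import Algebra.Bundles using (CommutativeMonoid; CommutativeRing)
open import Algebra.Bundles.Raw using (RawMonoid)
import Algebra.Definitions.RawMonoid as RawMonoidOps
import Algebra.Properties.CommutativeSemigroup as CommutativeSemigroupProperties
import Algebra.Properties.Ring as RingProperties
open import Data.Bool.Base using (Bool; true; false; if_then_else_; not; _∧_; _∨_)
import Data.Bool.Properties as Bool
open import Data.Empty using (⊥)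
open import Data.Fin.Base using (Fin; zero; suc) renaming (_<_ to _<ᶠ_)
open import Data.Fin.Permutation using (Permutation′; _⟨$⟩ʳ_; _⟨$⟩ˡ_; inverseʳ)
import Data.Fin.Properties as Fin
open import Data.Fin.Subset using (Subset; ⁅_⁆; ∣_∣) renaming (_∪_ to _∪ˢ_; _∩_ to _∩ˢ_)
import Data.Fin.Subset.Properties as Subset
open import Data.List.Base
  using (List; []; _∷_; _++_; map; deduplicate; filter; allFin; cartesianProduct; cartesianProductWith)
open import Data.List.Membership.Propositional using (_∈_; find; lose)
open import Data.List.Membership.Propositional.Properties
  using (∈-deduplicate⁺; ∈-map⁺; ∈-map⁻; ∈-++⁺ˡ; ∈-++⁺ʳ; ∈-++⁻; ∈-allFin; ∈-cartesianProduct⁺;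
         ∈-cartesianProductWith⁺; ∈-cartesianProductWith⁻; ∈-filter⁺; ∈-filter⁻)
open import Data.List.Relation.Unary.All as All using (All; []; _∷_)
open import Data.List.Relation.Unary.AllPairs using ([]; _∷_)
open import Data.List.Relation.Unary.Any using (Any; here; there)
open import Data.List.Relation.Unary.Unique.DecPropositional.Properties using (deduplicate-!)
open import Data.List.Relation.Unary.Unique.Propositional using (Unique)
open import Data.Nat.Base
  using (ℕ; zero; suc; _+_; _*_; _∸_; _≤_; _<_; z≤n; s≤s; z<s; parity; ⌊_/2⌋)
open import Data.Nat.Divisibility using (_∣_; _∣?_; divides; ∣-refl; ∣m∣n⇒∣m+n)
import Data.Nat.Properties as ℕ
open import Data.Parity.Base using (0ℙ; 1ℙ) renaming (_+_ to _+ℙ_; _*_ to _*ℙ_)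
import Data.Parity.Properties as ℙ
open import Data.Product using (∃-syntax; ∃₂; _×_; _,_; proj₁; proj₂)
open import Data.Sum.Base as Sum using (_⊎_; inj₁; inj₂; fromInj₂)
open import Data.Unit.Base using (tt)
open import Data.Vec.Base as Vec using ([]; _∷_; lookup; replicate; tabulate; zipWith; _[_]≔_)
import Data.Vec.Properties as Vec
open import Function.Base using (_∘_)
open import Function.Bundles using (_⇔_; mk⇔)
open import Relation.Binary.Core using (Rel)
open import Relation.Binary.Definitions using (DecidableEquality; tri<; tri≈; tri>)
open import Relation.Binary.PropositionalEquality
  using (_≡_; _≢_; refl; sym; trans; cong; cong₂; subst; subst₂; module ≡-Reasoning)
import Relation.Binary.Reasoning.Setoid as SetoidReasoning
open import Relation.Nullary.Decidable
  using (Dec; yes; no; does; ¬?; map′; _×-dec_; _⊎-dec_; _→-dec_; dec-true; dec-false)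
open import Relation.Nullary.Negation using (¬_; contradiction)
open import Relation.Unary using (Pred; Decidable; _⊆_; _∪_)

open import Algebra.Properties.CommutativeMonoid.Sum ℕ.+-0-commutativeMonoid
  using (sum-cong-≗; ∑-distrib-+) renaming (sum to ∑)
open CommutativeSemigroupProperties ℕ.+-commutativeSemigroup
  using () renaming (interchange to +-interchange)


-- Finite sums of natural numbers and arithmetic mod 2

private variable
  n : ℕ

∑-mono-≤ : {f g : Fin n → ℕ} → (∀ i → f i ≤ g i) → ∑ f ≤ ∑ g
∑-mono-≤ {zero}  f≤g = z≤n
∑-mono-≤ {suc n} f≤g = ℕ.+-mono-≤ (f≤g zero) (∑-mono-≤ (f≤g ∘ suc))

∑-mono-< : {f g : Fin n → ℕ} → (∀ i → f i ≤ g i) → ∀ k → f k < g k → ∑ f < ∑ g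
∑-mono-< f≤g zero    f<g = ℕ.+-mono-<-≤ f<g (∑-mono-≤ (f≤g ∘ suc))
∑-mono-< f≤g (suc k) f<g = ℕ.+-mono-≤-< (f≤g zero) (∑-mono-< (f≤g ∘ suc) k f<g)

∑≡0 : {f : Fin n → ℕ} → (∀ i → f i ≡ 0) → ∑ f ≡ 0
∑≡0 {zero}  f≡0 = refl
∑≡0 {suc n} f≡0 = cong₂ _+_ (f≡0 zero) (∑≡0 (f≡0 ∘ suc))

∑>0⇒∃>0 : {f : Fin n → ℕ} → 0 < ∑ f → ∃[ i ] 0 < f i
∑>0⇒∃>0 {suc n} {f} 0<∑ with f zero in eq
... | zero  = let i , p = ∑>0⇒∃>0 0<∑ in suc i , p
... | suc _ = zero , subst (0 <_) (sym eq) z<s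

parity-∑ : {f g : Fin n → ℕ} → (∀ i → parity (f i) ≡ parity (g i)) →
           parity (∑ f) ≡ parity (∑ g)
parity-∑ {zero}          f≡g = refl
parity-∑ {suc n} {f} {g} f≡g = begin
  parity (f zero + ∑ (f ∘ suc))          ≡⟨ ℙ.+-homo-+ (f zero) _ ⟩
  parity (f zero) +ℙ parity (∑ (f ∘ suc)) ≡⟨ cong₂ _+ℙ_ (f≡g zero) (parity-∑ (f≡g ∘ suc)) ⟩
  parity (g zero) +ℙ parity (∑ (g ∘ suc)) ≡⟨ ℙ.+-homo-+ (g zero) _ ⟨
  parity (g zero + ∑ (g ∘ suc))          ∎
  where open ≡-Reasoning

parity-+≡0⇒≡ : ∀ m n → parity (m + n) ≡ 0ℙ → parity m ≡ parity n
parity-+≡0⇒≡ m n p = ℙ.+-cancelʳ-≡ (parity n) _ _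
  (trans (sym (ℙ.+-homo-+ m n)) (trans p (sym (ℙ.p+p≡0ℙ (parity n)))))

parity-≡⇒+≡0 : ∀ m n → parity m ≡ parity n → parity (m + n) ≡ 0ℙ
parity-≡⇒+≡0 m n p = trans (ℙ.+-homo-+ m n) (trans (cong (_+ℙ parity n) p) (ℙ.p+p≡0ℙ (parity n)))

2∣⇒parity≡0 : ∀ {n} → 2 ∣ n → parity n ≡ 0ℙ
2∣⇒parity≡0 (divides q refl) = trans (ℙ.*-homo-* q 2) (ℙ.*-zeroʳ (parity q))

parity≡0⇒2∣ : ∀ n → parity n ≡ 0ℙ → 2 ∣ n
parity≡0⇒2∣ zero          _ = divides 0 refl
parity≡0⇒2∣ (suc (suc n)) p = ∣m∣n⇒∣m+n ∣-refl (parity≡0⇒2∣ n p)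

bit : Bool → ℕ
bit b = if b then 1 else 0

bit≤1 : ∀ b → bit b ≤ 1
bit≤1 false = z≤n
bit≤1 true  = ℕ.≤-refl

∧-trueˡ : ∀ {a b} → a ∧ b ≡ true → a ≡ true
∧-trueˡ {true} _ = refl

-- Read off from `parity`, whose homomorphism laws drive all counting mod 2; `lookup-oddEdges`
-- matches it with the divisibility test in `oddEdges`.
odd : ℕ → Bool
odd n = does (parity n ℙ.≟ 1ℙ)

odd-even : ∀ n → parity n ≡ 0ℙ → odd n ≡ false
odd-even n p rewrite p = refl

parity-bit-odd : ∀ n → parity (bit (odd n)) ≡ parity n
parity-bit-odd n with parity n
... | 0ℙ = refl
... | 1ℙ = refl

bit-odd≤ : ∀ n → bit (odd n) ≤ n
bit-odd≤ zero          = z≤n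
bit-odd≤ (suc zero)    = ℕ.≤-refl
bit-odd≤ (suc (suc n)) = ℕ.m≤n⇒m≤1+n (ℕ.m≤n⇒m≤1+n (bit-odd≤ n))

-- The even part is a sum of two equal numbers and not a multiple of 2, since `odd-half-split` turns
-- it into the product of a monomial with itself.
odd-halves : ∀ n → n ≡ bit (odd n) + (⌊ n /2⌋ + ⌊ n /2⌋)
odd-halves zero          = refl
odd-halves (suc zero)    = refl
odd-halves (suc (suc n)) = begin
  suc (suc n)                          ≡⟨ cong (λ x → suc (suc x)) (odd-halves n) ⟩
  suc (suc (b + (h + h)))              ≡⟨ cong suc (ℕ.+-suc b (h + h)) ⟨
  suc (b + suc (h + h))                ≡⟨ ℕ.+-suc b (suc (h + h)) ⟨
  b + suc (suc (h + h))                ≡⟨ cong (λ x → b + suc x) (ℕ.+-suc h h) ⟨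
  b + (suc h + suc h)                  ∎
  where
  open ≡-Reasoning
  b = bit (odd n)
  h = ⌊ n /2⌋

∣tabulate∣ : ∀ (p : Fin n → Bool) → ∣ tabulate p ∣ ≡ ∑ (bit ∘ p)
∣tabulate∣ {zero}  p = refl
∣tabulate∣ {suc n} p with p zero
... | true  = cong suc (∣tabulate∣ (p ∘ suc))
... | false = ∣tabulate∣ (p ∘ suc)

∣∣≡∑ : ∀ (p : Subset n) → ∣ p ∣ ≡ ∑ (bit ∘ lookup p)
∣∣≡∑ p = trans (cong ∣_∣ (sym (Vec.tabulate∘lookup p))) (∣tabulate∣ (lookup p))

degree≡∑ : ∀ (α : Monomial n) → degree α ≡ ∑ (lookup α)
degree≡∑ []      = refl
degree≡∑ (x ∷ α) = cong (x +_) (degree≡∑ α)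

degree-tabulate : ∀ (f : Fin n → ℕ) → degree (tabulate f) ≡ ∑ f
degree-tabulate {zero}  f = refl
degree-tabulate {suc n} f = cong (f zero +_) (degree-tabulate (f ∘ suc))

-- Boolean-valued subsets of `Fin n`

infix 4 _⊑_
_⊑_ : (p q : Fin n → Bool) → Set
p ⊑ q = ∀ i → p i ≡ true → q i ≡ true

-- A greedy choice: `q` consists of the first `r` elements of `p`.
subset-of-size : ∀ (p : Fin n → Bool) r → r ≤ ∑ (bit ∘ p) →
                 ∃[ q ] (q ⊑ p × ∑ (bit ∘ q) ≡ r)
subset-of-size {n} p zero _ = (λ _ → false) , (λ _ ()) , ∑≡0 {n} (λ _ → refl)
subset-of-size {suc n} p (suc r) r≤ with p zero in p₀
... | true  = let q , q⊑p , ∣q∣≡r = subset-of-size (p ∘ suc) r (ℕ.≤-pred r≤) in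
  (λ { zero → true ; (suc i) → q i }) ,
  (λ { zero _ → p₀ ; (suc i) → q⊑p i }) ,
  cong suc ∣q∣≡r
... | false = let q , q⊑p , ∣q∣≡r = subset-of-size (p ∘ suc) (suc r) r≤ in
  (λ { zero → false ; (suc i) → q i }) ,
  (λ { zero () ; (suc i) → q⊑p i }) ,
  ∣q∣≡r

-- The tail is searched first, so `zero` is returned only when no larger index satisfies `P`.
last : ∀ {ℓ} {P : Pred (Fin n) ℓ} → Decidable P → ∃[ i ] P i →
       ∃[ k ] (P k × (∀ j → k <ᶠ j → ¬ P j))
last {n = suc n} P? (i , Pi) with Fin.any? (P? ∘ suc)
... | yes ∃P = let k , Pk , ¬P = last (P? ∘ suc) ∃P in
  suc k , Pk , λ { (suc j) (s≤s k<j) → ¬P j k<j }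
last {n = suc n} P? (zero  , Pi) | no ∄P = zero , Pi , λ { (suc j) _ Pj → ∄P (j , Pj) }
last {n = suc n} P? (suc i , Pi) | no ∄P = contradiction (i , Pi) ∄P

_without_ : (Fin n → Bool) → Fin n → Fin n → Bool
(p without k) i = p i ∧ not (does (i Fin.≟ k))

without-self : ∀ (p : Fin n → Bool) k → (p without k) k ≡ false
without-self p k rewrite dec-true (k Fin.≟ k) refl = Bool.∧-zeroʳ (p k)

∑-without : ∀ (p : Fin n → Bool) k → ∑ (bit ∘ p) ≤ suc (∑ (bit ∘ (p without k)))
∑-without {suc n} p zero = ℕ.+-mono-≤ (bit≤1 (p zero)) (begin
  ∑ (bit ∘ p ∘ suc)                      ≡⟨ sum-cong-≗ (λ i → cong bit (Bool.∧-identityʳ (p (suc i)))) ⟨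
  ∑ (bit ∘ (p without zero) ∘ suc)       ≤⟨ ℕ.m≤n+m _ _ ⟩
  ∑ (bit ∘ (p without zero))             ∎)
  where open ℕ.≤-Reasoning
∑-without {suc n} p (suc k) = begin
  bit (p zero) + ∑ (bit ∘ p ∘ suc)
    ≤⟨ ℕ.+-mono-≤ (ℕ.≤-reflexive (cong bit (sym (Bool.∧-identityʳ (p zero))))) (∑-without (p ∘ suc) k) ⟩
  bit (p zero ∧ true) + suc (∑ (bit ∘ ((p ∘ suc) without k)))
    ≡⟨ ℕ.+-suc _ _ ⟩
  suc (∑ (bit ∘ (p without suc k))) ∎
  where open ℕ.≤-Reasoning


-- Monomials

𝟏 : Monomial n
𝟏 = replicate _ 0

unit : Fin n → Monomial n
unit i = 𝟏 [ i ]≔ 1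

-- Has the shape to which the exponent of `var i ^ 2` unfolds, so that in
-- `squareDifference≈binomial` only coefficients remain to be compared.
square : Fin n → Monomial n
square i = unit i · (unit i · 𝟏)

lookup-· : ∀ (α β : Monomial n) i → lookup (α · β) i ≡ lookup α i + lookup β i
lookup-· α β i = Vec.lookup-zipWith _+_ i α β

lookup-injective : {α β : Monomial n} → (∀ i → lookup α i ≡ lookup β i) → α ≡ β
lookup-injective {α = α} {β} p =
  trans (sym (Vec.tabulate∘lookup α)) (trans (Vec.tabulate-cong p) (Vec.tabulate∘lookup β))

·-comm : ∀ (α β : Monomial n) → α · β ≡ β · α
·-comm = Vec.zipWith-comm ℕ.+-comm

·-identityˡ : ∀ (α : Monomial n) → 𝟏 · α ≡ α
·-identityˡ = Vec.zipWith-identityˡ ℕ.+-identityˡ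

·-identityʳ : ∀ (α : Monomial n) → α · 𝟏 ≡ α
·-identityʳ = Vec.zipWith-identityʳ ℕ.+-identityʳ

degree-· : ∀ (α β : Monomial n) → degree (α · β) ≡ degree α + degree β
degree-· []      []      = refl
degree-· (x ∷ α) (y ∷ β) = begin
  x + y + degree (α · β)          ≡⟨ cong (x + y +_) (degree-· α β) ⟩
  x + y + (degree α + degree β)   ≡⟨ ℕ.+-assoc x y _ ⟩
  x + (y + (degree α + degree β)) ≡⟨ cong (x +_) (ℕ.+-comm y _) ⟩
  x + (degree α + degree β + y)   ≡⟨ cong (x +_) (ℕ.+-assoc (degree α) _ y) ⟩
  x + (degree α + (degree β + y)) ≡⟨ ℕ.+-assoc x _ _ ⟨
  x + degree α + (degree β + y)   ≡⟨ cong (x + degree α +_) (ℕ.+-comm _ y) ⟩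
  x + degree α + (y + degree β)   ∎
  where open ≡-Reasoning

degree-𝟏 : degree (𝟏 {n}) ≡ 0
degree-𝟏 {zero}  = refl
degree-𝟏 {suc n} = degree-𝟏 {n}

degree-unit : ∀ (i : Fin n) → degree (unit i) ≡ 1
degree-unit {suc n} zero    = cong suc (degree-𝟏 {n})
degree-unit {suc n} (suc i) = degree-unit i

degree-square : ∀ (i : Fin n) → degree (square i) ≡ 2
degree-square {n} i = begin
  degree (unit i · (unit i · 𝟏))       ≡⟨ degree-· (unit i) _ ⟩
  degree (unit i) + degree (unit i · 𝟏) ≡⟨ cong (λ α → degree (unit i) + degree α) (·-identityʳ (unit i)) ⟩
  degree (unit i) + degree (unit i)     ≡⟨ cong₂ _+_ (degree-unit i) (degree-unit i) ⟩
  2                                     ∎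
  where open ≡-Reasoning

lookup-unit : ∀ (i j : Fin n) → lookup (unit i) j ≡ bit (lookup ⁅ i ⁆ j)
lookup-unit zero    zero    = refl
lookup-unit zero    (suc j) = trans (Vec.lookup-replicate j 0) (cong bit (sym (Vec.lookup-replicate j false)))
lookup-unit (suc i) zero    = refl
lookup-unit (suc i) (suc j) = lookup-unit i j

lookup-unit-≡ : ∀ (i : Fin n) → lookup (unit i) i ≡ 1
lookup-unit-≡ i = Vec.lookup∘update i 𝟏 1

lookup-unit-≢ : ∀ {i j : Fin n} → i ≢ j → lookup (unit i) j ≡ 0
lookup-unit-≢ {i = i} {j} i≢j =
  trans (Vec.lookup∘update′ (i≢j ∘ sym) 𝟏 1) (Vec.lookup-replicate j 0)

lookup-square : ∀ (i j : Fin n) → lookup (square i) j ≡ lookup (unit i) j + lookup (unit i) j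
lookup-square i j = trans (lookup-· (unit i) _ j)
  (cong (λ α → lookup (unit i) j + lookup α j) (·-identityʳ (unit i)))

parity-double : ∀ m → parity (m + m) ≡ 0ℙ
parity-double m = parity-≡⇒+≡0 m m refl

-- Eulerian pairs and their leading monomials

module ParityClasses {c ℓ₁ ℓ₂} (K : HeytingField c ℓ₁ ℓ₂) (G : Graph) where
  open Graph G
  open Eulerian K G

  private variable
    α β : Monomial size

  -- The exponent of the variable `v` in the image of `α` under `φ`; see `lookup-∂`.
  degreeAt : Monomial size → Fin order → ℕ
  degreeAt α v = ∑ (λ h → lookup α h * bit (lookup (edge h) v))

  infix 4 _≋_
  -- The images under `φ` are congruent modulo the squares. The degree is that of the monomial
  -- itself, half the degree of its image.
  _≋_ : Monomial size → Monomial size → Set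
  α ≋ β = degree α ≡ degree β × (∀ v → parity (degreeAt α v) ≡ parity (degreeAt β v))

  -- `D` is the set of edges at which `α` and `β` differ in parity. As an equation between parities
  -- this can be summed over the edges by `parity-∑`.
  IsOddPart : Subset size → Monomial size → Monomial size → Set
  IsOddPart D α β = ∀ h → parity (bit (lookup D h)) ≡ parity (lookup α h + lookup β h)

  -- Mod 2, membership in `D` may be replaced by the sum of the two exponents, which splits the
  -- count of edges at `v` into two weighted degrees.
  parity-degreeIn : ∀ α β D → IsOddPart D α β → ∀ v →
                    parity (degreeIn D v) ≡ parity (degreeAt α v + degreeAt β v)
  parity-degreeIn α β D odd v = begin
    parity ∣ D ∩ˢ incident v ∣
      ≡⟨ cong parity (∣∣≡∑ (D ∩ˢ incident v)) ⟩
    parity (∑ (bit ∘ lookup (D ∩ˢ incident v)))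
      ≡⟨ parity-∑ lemma ⟩
    parity (∑ (λ h → lookup α h * inc h + lookup β h * inc h))
      ≡⟨ cong parity (∑-distrib-+ (λ h → lookup α h * inc h) (λ h → lookup β h * inc h)) ⟩
    parity (degreeAt α v + degreeAt β v) ∎
    where
    open ≡-Reasoning
    inc : Fin size → ℕ
    inc h = bit (lookup (edge h) v)
    bit-∧ : ∀ b b′ → bit (b ∧ b′) ≡ bit b * bit b′
    bit-∧ false b′ = refl
    bit-∧ true  b′ = sym (ℕ.*-identityˡ (bit b′))
    lemma : ∀ h → parity (bit (lookup (D ∩ˢ incident v) h)) ≡
                  parity (lookup α h * inc h + lookup β h * inc h)
    lemma h = begin
      parity (bit (lookup (D ∩ˢ incident v) h))
        ≡⟨ cong (parity ∘ bit) (trans (Vec.lookup-zipWith _∧_ h D (incident v)) (cong (lookup D h ∧_) (Vec.lookup∘tabulate _ h))) ⟩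
      parity (bit (lookup D h ∧ lookup (edge h) v))
        ≡⟨ cong parity (bit-∧ (lookup D h) (lookup (edge h) v)) ⟩
      parity (bit (lookup D h) * inc h)
        ≡⟨ ℙ.*-homo-* (bit (lookup D h)) (inc h) ⟩
      parity (bit (lookup D h)) *ℙ parity (inc h)
        ≡⟨ cong (_*ℙ parity (inc h)) (odd h) ⟩
      parity (lookup α h + lookup β h) *ℙ parity (inc h)
        ≡⟨ ℙ.*-homo-* (lookup α h + lookup β h) (inc h) ⟨
      parity ((lookup α h + lookup β h) * inc h)
        ≡⟨ cong parity (ℕ.*-distribʳ-+ (inc h) (lookup α h) (lookup β h)) ⟩
      parity (lookup α h * inc h + lookup β h * inc h) ∎

  parity-∣∣ : ∀ α β D → IsOddPart D α β → parity ∣ D ∣ ≡ parity (degree α + degree β)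
  parity-∣∣ α β D odd = begin
    parity ∣ D ∣                               ≡⟨ cong parity (∣∣≡∑ D) ⟩
    parity (∑ (bit ∘ lookup D))                ≡⟨ parity-∑ odd ⟩
    parity (∑ (λ h → lookup α h + lookup β h)) ≡⟨ cong parity (∑-distrib-+ (lookup α) (lookup β)) ⟩
    parity (∑ (lookup α) + ∑ (lookup β))       ≡⟨ cong₂ (λ x y → parity (x + y)) (degree≡∑ α) (degree≡∑ β) ⟨
    parity (degree α + degree β)               ∎
    where open ≡-Reasoning

  ≋⇒evenEulerian : ∀ α β D → IsOddPart D α β → α ≋ β → EvenEulerian D
  ≋⇒evenEulerian α β D odd (deg , par) =
    (λ v _ → parity≡0⇒2∣ _ (trans (parity-degreeIn α β D odd v) (parity-≡⇒+≡0 (degreeAt α v) (degreeAt β v) (par v)))) ,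
    parity≡0⇒2∣ _ (trans (parity-∣∣ α β D odd) (parity-≡⇒+≡0 (degree α) (degree β) (cong parity deg)))

  -- The cardinality of `D` only yields that the degrees agree mod 2, so their equality is assumed.
  evenEulerian⇒≋ : ∀ α β D → IsOddPart D α β → degree α ≡ degree β → EvenEulerian D → α ≋ β
  evenEulerian⇒≋ α β D odd deg (even , _) =
    deg , λ v → parity-+≡0⇒≡ (degreeAt α v) (degreeAt β v) (trans (sym (parity-degreeIn α β D odd v)) (2∣⇒parity≡0 (even′ v)))
    where
    even′ : ∀ v → 2 ∣ degreeIn D v
    -- `EvenEulerian` speaks only of vertices of the induced subgraph. At any other vertex no edge
    -- of `D` is incident and the degree is 0.
    even′ v with Subset.nonempty? (D ∩ˢ incident v)
    ... | yes (h , h∈) = let h∈D , h∈v = Subset.x∈p∩q⁻ D _ h∈ in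
      even v (h , h∈D , Vec.lookup⇒[]= v (edge h) (trans (sym (Vec.lookup∘tabulate _ h)) (Vec.[]=⇒lookup h∈v)))
    ... | no empty = divides 0 (trans (cong ∣_∣ (Subset.Empty-unique empty)) (Subset.∣⊥∣≡0 size))

  lookup-oddEdges : ∀ α h → lookup (oddEdges α) h ≡ odd (lookup α h)
  lookup-oddEdges α h = trans (Vec.lookup∘tabulate _ h) (lemma (2 ∣? lookup α h))
    where
    lemma : ∀ {m} (d : Dec (2 ∣ m)) → does (¬? d) ≡ odd m
    lemma {m} (yes 2∣m) = sym (odd-even m (2∣⇒parity≡0 2∣m))
    lemma {m} (no  2∤m) with parity m in eq
    ... | 0ℙ = contradiction (parity≡0⇒2∣ m eq) 2∤m
    ... | 1ℙ = refl

  -- At every edge one of the exponents is 0, so no edge is odd in both and the union is the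
  -- symmetric difference.
  isOddPart-oddEdges : RelativelyPrime α β → IsOddPart (oddEdges α ∪ˢ oddEdges β) α β
  isOddPart-oddEdges {α} {β} prime h = begin
    parity (bit (lookup (oddEdges α ∪ˢ oddEdges β) h))
      ≡⟨ cong (parity ∘ bit) (Vec.lookup-zipWith _∨_ h (oddEdges α) (oddEdges β)) ⟩
    parity (bit (lookup (oddEdges α) h ∨ lookup (oddEdges β) h))
      ≡⟨ cong₂ (λ x y → parity (bit (x ∨ y))) (lookup-oddEdges α h) (lookup-oddEdges β h) ⟩
    parity (bit (odd (lookup α h) ∨ odd (lookup β h)))
      ≡⟨ lemma (prime h) ⟩
    parity (lookup α h + lookup β h) ∎
    where
    open ≡-Reasoning
    lemma : ∀ {x y} → x ≡ 0 ⊎ y ≡ 0 → parity (bit (odd x ∨ odd y)) ≡ parity (x + y)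
    lemma {y = y} (inj₁ refl) = parity-bit-odd y
    lemma {x} (inj₂ refl) = begin
      parity (bit (odd x ∨ false)) ≡⟨ cong (parity ∘ bit) (Bool.∨-identityʳ (odd x)) ⟩
      parity (bit (odd x))         ≡⟨ parity-bit-odd x ⟩
      parity x                     ≡⟨ cong parity (ℕ.+-identityʳ x) ⟨
      parity (x + 0)               ∎

  eulerianPair⇒≋ : IsEulerianPair α β → α ≋ β
  eulerianPair⇒≋ {α} {β} p = evenEulerian⇒≋ α β _ (isOddPart-oddEdges {α} {β} relativelyPrime) sameDegree evenEulerian
    where open IsEulerianPair p

  square-≋ : ∀ h l → square h ≋ square l
  square-≋ h l = trans (degree-square h) (sym (degree-square l)) , λ v → trans (even h v) (sym (even l v))
    where
    even : ∀ h v → parity (degreeAt (square h) v) ≡ 0ℙ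
    even h v = trans (parity-∑ {g = λ _ → 0} lemma) (cong parity (∑≡0 {size} (λ _ → refl)))
      where
      lemma : ∀ k → parity (lookup (square h) k * bit (lookup (edge k) v)) ≡ 0ℙ
      lemma k = trans (ℙ.*-homo-* (lookup (square h) k) _)
        (cong (_*ℙ parity (bit (lookup (edge k) v)))
          (trans (cong parity (lookup-square h k)) (parity-double (lookup (unit h) k))))

  module _ (ε : Permutation′ size) where

    -- The degrees agree, and the comparison is made at the last position `ℓ`, where the exponents
    -- are 2 and 0 and beyond which there is nothing to check.
    grevlex-square : ∀ {ℓ h} → (∀ j → ¬ ℓ <ᶠ j) → h ≢ ε ⟨$⟩ʳ ℓ →
                     Grevlex ε (square (ε ⟨$⟩ʳ ℓ)) (square h)
    grevlex-square {ℓ} {h} last h≢s =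
      inj₂ (trans (degree-square s) (sym (degree-square h)) , ℓ ,
            subst₂ _<_ (sym (trans (lookup-square h s) (cong (λ x → x + x) (lookup-unit-≢ h≢s))))
                       (sym (trans (lookup-square s s) (cong (λ x → x + x) (lookup-unit-≡ s)))) z<s ,
            λ j ℓ<j → contradiction ℓ<j (last j))
      where s = ε ⟨$⟩ʳ ℓ

    square-≤ : ∀ {h} → 2 ≤ lookup α h → ∀ j → lookup (square h) j ≤ lookup α j
    square-≤ {α} {h} 2≤ j with h Fin.≟ j
    ... | yes refl = subst (_≤ lookup α h) (sym (trans (lookup-square h h) (cong (λ x → x + x) (lookup-unit-≡ h)))) 2≤
    ... | no h≢j   = subst (_≤ lookup α j) (sym (trans (lookup-square h j) (cong (λ x → x + x) (lookup-unit-≢ h≢j)))) z≤n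

    -- Splitting an even Eulerian set of edges into two halves

    module _ (D : Fin size → Bool) (even : EvenEulerian (tabulate D))
             (S : Fin size → Bool) (S⊑D : S ⊑ D)
             (half : ∑ (bit ∘ D) ≡ ∑ (bit ∘ S) + ∑ (bit ∘ S))
             {k} (Dk : D (ε ⟨$⟩ʳ k) ≡ true) (Sk : S (ε ⟨$⟩ʳ k) ≡ false)
             (D>k : ∀ j → k <ᶠ j → D (ε ⟨$⟩ʳ j) ≡ false) where

      private
        T : Fin size → Bool
        T h = D h ∧ not (S h)

        α₀ β₀ : Monomial size
        α₀ = tabulate (bit ∘ S)
        β₀ = tabulate (bit ∘ T)

        lookup-α₀ : ∀ h → lookup α₀ h ≡ bit (S h)
        lookup-α₀ = Vec.lookup∘tabulate (bit ∘ S)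
        lookup-β₀ : ∀ h → lookup β₀ h ≡ bit (T h)
        lookup-β₀ = Vec.lookup∘tabulate (bit ∘ T)

        split : ∀ h → bit (D h) ≡ bit (S h) + bit (T h)
        split h with S h in s | D h in d
        ... | false | true  = refl
        ... | false | false = refl
        ... | true  | true  = refl
        ... | true  | false = contradiction (trans (sym d) (S⊑D h s)) λ ()

        odd-bit : ∀ b → odd (bit b) ≡ b
        odd-bit true  = refl
        odd-bit false = refl

        odd-union : oddEdges α₀ ∪ˢ oddEdges β₀ ≡ tabulate D
        odd-union = trans (sym (Vec.tabulate∘lookup _)) (Vec.tabulate-cong λ h →
          trans (Vec.lookup-zipWith _∨_ h (oddEdges α₀) (oddEdges β₀)) (trans
            (cong₂ _∨_ (trans (lookup-oddEdges α₀ h) (trans (cong odd (lookup-α₀ h)) (odd-bit (S h))))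
                       (trans (lookup-oddEdges β₀ h) (trans (cong odd (lookup-β₀ h)) (odd-bit (T h)))))
            (lemma h)))
          where
          lemma : ∀ h → S h ∨ T h ≡ D h
          lemma h with S h in s
          ... | true  = sym (S⊑D h s)
          ... | false = Bool.∧-identityʳ (D h)

        -- `S` and `T` partition `D`, which has twice the size of `S`; cancelling one copy of `S`
        -- leaves equal sizes.
        same : degree β₀ ≡ degree α₀
        same = begin
          degree β₀     ≡⟨ degree-tabulate (bit ∘ T) ⟩
          ∑ (bit ∘ T)   ≡⟨ ℕ.+-cancelˡ-≡ (∑ (bit ∘ S)) _ _ (begin
            ∑ (bit ∘ S) + ∑ (bit ∘ T)     ≡⟨ ∑-distrib-+ (bit ∘ S) (bit ∘ T) ⟨
            ∑ (λ h → bit (S h) + bit (T h)) ≡⟨ sum-cong-≗ split ⟨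
            ∑ (bit ∘ D)                   ≡⟨ half ⟩
            ∑ (bit ∘ S) + ∑ (bit ∘ S)     ∎) ⟩
          ∑ (bit ∘ S)   ≡⟨ degree-tabulate (bit ∘ S) ⟨
          degree α₀     ∎
          where open ≡-Reasoning

        α₀k<β₀k : lookup α₀ (ε ⟨$⟩ʳ k) < lookup β₀ (ε ⟨$⟩ʳ k)
        α₀k<β₀k = subst₂ _<_ (sym (trans (lookup-α₀ _) (cong bit Sk)))
          (sym (trans (lookup-β₀ _) (cong bit (cong₂ (λ x y → x ∧ not y) Dk Sk)))) z<s

      -- The last element of `D` was put into `T`. Beyond it both exponents are 0, so it decides the
      -- comparison, and there `β₀` has the larger exponent.
      halving-grevlex : Grevlex ε β₀ α₀
      halving-grevlex = inj₂ (same , k , α₀k<β₀k , λ j k<j → 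
        trans (lookup-β₀ _) (trans (zero-T (D>k j k<j)) (trans (sym (zero-S (D>k j k<j))) (sym (lookup-α₀ _)))))
        where
        zero-T : ∀ {h} → D h ≡ false → bit (T h) ≡ 0
        zero-T d rewrite d = refl
        zero-S : ∀ {h} → D h ≡ false → bit (S h) ≡ 0
        zero-S {h} d with S h in s
        ... | false = refl
        ... | true  = contradiction (trans (sym d) (S⊑D h s)) λ ()

      halving-eulerian : IsEulerianPair α₀ β₀
      halving-eulerian = record
        { distinct        = λ α≡β → ℕ.<-irrefl (cong (λ α → lookup α (ε ⟨$⟩ʳ k)) α≡β) α₀k<β₀k
        ; relativelyPrime = prime
        ; squareFreeˡ     = λ h → subst (_≤ 1) (sym (lookup-α₀ h)) (bit≤1 _)
        ; squareFreeʳ     = λ h → subst (_≤ 1) (sym (lookup-β₀ h)) (bit≤1 _)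
        ; sameDegree      = sym same
        ; evenEulerian    = subst EvenEulerian (sym odd-union) even
        }
        where
        prime : RelativelyPrime α₀ β₀
        prime h rewrite lookup-α₀ h | lookup-β₀ h with S h | D h
        ... | false | _     = inj₁ refl
        ... | true  | true  = inj₂ refl
        ... | true  | false = inj₂ refl

    -- Reduction when only the smallest variable may have an exponent above 1

    module _ (m m′ : Monomial size) (m≋m′ : m ≋ m′) {ℓ k : Fin size}
             (last-ℓ : ∀ (j : Fin size) → ¬ ℓ <ᶠ j)
             (mk<m′k : lookup m (ε ⟨$⟩ʳ k) < lookup m′ (ε ⟨$⟩ʳ k))
             (m>k : ∀ j → k <ᶠ j → lookup m′ (ε ⟨$⟩ʳ j) ≡ lookup m (ε ⟨$⟩ʳ j))
             (m≤1 : ∀ h → h ≢ ε ⟨$⟩ʳ ℓ → lookup m h ≤ 1) where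

      private
        s : Fin size
        s = ε ⟨$⟩ʳ ℓ

        -- D is to be halved into α, which must divide m and avoid the last element of D, and β.
        -- The candidates for α are the elements of A.
        D A B : Fin size → Bool
        D h = odd (lookup m h + lookup m′ h)
        A = (λ h → D h ∧ odd (lookup m h)) without s
        B h = D h ∧ not (A h)

        A⊑D : A ⊑ D
        A⊑D h with D h
        ... | true  = λ _ → refl
        ... | false = λ ()

        -- Either `s` lies beyond the deciding position `k`, where the exponents agree, or `s` is at
        -- `k`, where `m′` has the larger one.
        ms≤m′s : lookup m s ≤ lookup m′ s
        ms≤m′s with Fin.<-cmp k ℓ
        ... | tri< k<ℓ _ _ = ℕ.≤-reflexive (sym (m>k ℓ k<ℓ))
        ... | tri≈ _ refl _ = ℕ.<⇒≤ mk<m′k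
        ... | tri> _ _ ℓ<k = contradiction ℓ<k (last-ℓ k)

        -- If `x` is 0, the edge can only be in `B`, and then `y` is odd, hence positive. If `x` is
        -- 1, the edge is in `A`, or `y` is odd as well and pays for `x`.
        off-last : ∀ {x} y → x ≤ 1 → let d = odd (x + y) in
                   bit (d ∧ not (d ∧ odd x)) + x ≤ bit (d ∧ odd x) + y
        off-last {zero} y z≤n rewrite Bool.∧-zeroʳ (odd y) | Bool.∧-identityʳ (odd y) | ℕ.+-identityʳ (bit (odd y)) =
          bit-odd≤ y
        off-last {suc zero} zero    (s≤s z≤n) = ℕ.≤-refl
        off-last {suc zero} (suc y) (s≤s z≤n) with odd (suc (suc y))
        ... | true  = s≤s z≤n
        ... | false = s≤s z≤n

        -- Since `A` leaves out `s`, membership of `s` in `D` costs 1 on the left. A strict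
        -- inequality has room for it, and for `x` equal to `y` the sum is even.
        at-last : ∀ {x y} → x ≤ y → bit (odd (x + y)) + x ≤ y
        at-last {x} {y} x≤y with ℕ.m≤n⇒m<n∨m≡n x≤y
        ... | inj₁ x<y  = ℕ.≤-trans (ℕ.+-monoˡ-≤ x (bit≤1 (odd (x + y)))) x<y
        ... | inj₂ refl rewrite odd-even (x + x) (parity-double x) = ℕ.≤-refl

        -- Summed over h, with degree m ≡ degree m′, this gives ∣ B ∣ ≤ ∣ A ∣.
        balance : ∀ h → bit (B h) + lookup m h ≤ bit (A h) + lookup m′ h
        balance h with h Fin.≟ s
        ... | no h≢s rewrite Bool.∧-identityʳ (D h ∧ odd (lookup m h)) = off-last (lookup m′ h) (m≤1 h h≢s)
        ... | yes refl rewrite Bool.∧-zeroʳ (D h ∧ odd (lookup m h)) | Bool.∧-identityʳ (D h) = at-last ms≤m′s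

        ∑+degree : ∀ (p : Fin size → Bool) α →
                   ∑ (λ h → bit (p h) + lookup α h) ≡ ∑ (bit ∘ p) + degree α
        ∑+degree p α = trans (∑-distrib-+ (bit ∘ p) (lookup α)) (cong (∑ (bit ∘ p) +_) (sym (degree≡∑ α)))

        -- The equal degrees of `m` and `m′` cancel. The slack `x` is 0 for the weak bound and 1 for
        -- the strict one.
        sum-bound : ∀ {x} → ∑ (bit ∘ B) + degree m + x ≤ ∑ (bit ∘ A) + degree m′ → ∑ (bit ∘ B) + x ≤ ∑ (bit ∘ A)
        sum-bound {x} p = ℕ.+-cancelʳ-≤ (degree m) _ _ (begin
          ∑ (bit ∘ B) + x + degree m     ≡⟨ ℕ.+-assoc (∑ (bit ∘ B)) x (degree m) ⟩
          ∑ (bit ∘ B) + (x + degree m)   ≡⟨ cong (∑ (bit ∘ B) +_) (ℕ.+-comm x (degree m)) ⟩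
          ∑ (bit ∘ B) + (degree m + x)   ≡⟨ ℕ.+-assoc (∑ (bit ∘ B)) (degree m) x ⟨
          ∑ (bit ∘ B) + degree m + x     ≤⟨ p ⟩
          ∑ (bit ∘ A) + degree m′        ≡⟨ cong (∑ (bit ∘ A) +_) (proj₁ m≋m′) ⟨
          ∑ (bit ∘ A) + degree m         ∎)
          where open ℕ.≤-Reasoning

        ∣B∣≤∣A∣ : ∑ (bit ∘ B) ≤ ∑ (bit ∘ A)
        ∣B∣≤∣A∣ = subst (_≤ ∑ (bit ∘ A)) (ℕ.+-identityʳ _) (sum-bound (begin
          ∑ (bit ∘ B) + degree m + 0         ≡⟨ ℕ.+-identityʳ _ ⟩
          ∑ (bit ∘ B) + degree m             ≡⟨ ∑+degree B m ⟨
          ∑ (λ h → bit (B h) + lookup m h)   ≤⟨ ∑-mono-≤ balance ⟩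
          ∑ (λ h → bit (A h) + lookup m′ h)  ≡⟨ ∑+degree A m′ ⟩
          ∑ (bit ∘ A) + degree m′            ∎))
          where open ℕ.≤-Reasoning

        ∣B∣<∣A∣ : B (ε ⟨$⟩ʳ k) ≡ false → ∑ (bit ∘ B) < ∑ (bit ∘ A)
        ∣B∣<∣A∣ Bk = subst (_≤ ∑ (bit ∘ A)) (ℕ.+-comm _ 1) (sum-bound (begin
          ∑ (bit ∘ B) + degree m + 1             ≡⟨ ℕ.+-comm _ 1 ⟩
          suc (∑ (bit ∘ B) + degree m)           ≡⟨ cong suc (∑+degree B m) ⟨
          suc (∑ (λ h → bit (B h) + lookup m h)) ≤⟨ ∑-mono-< balance (ε ⟨$⟩ʳ k) at-k ⟩
          ∑ (λ h → bit (A h) + lookup m′ h)      ≡⟨ ∑+degree A m′ ⟩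
          ∑ (bit ∘ A) + degree m′                ∎))
          where
          open ℕ.≤-Reasoning
          at-k : bit (B (ε ⟨$⟩ʳ k)) + lookup m (ε ⟨$⟩ʳ k) < bit (A (ε ⟨$⟩ʳ k)) + lookup m′ (ε ⟨$⟩ʳ k)
          at-k rewrite Bk = ℕ.≤-trans mk<m′k (ℕ.m≤n+m _ _)

        ∣D∣≡∣A∣+∣B∣ : ∑ (bit ∘ D) ≡ ∑ (bit ∘ A) + ∑ (bit ∘ B)
        ∣D∣≡∣A∣+∣B∣ = trans (sum-cong-≗ split) (∑-distrib-+ (bit ∘ A) (bit ∘ B))
          where
          lemma : ∀ d a → (a ≡ true → d ≡ true) → bit d ≡ bit a + bit (d ∧ not a)
          lemma d     false _ = cong bit (sym (Bool.∧-identityʳ d))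
          lemma true  true  _ = refl
          lemma false true  f = contradiction (f refl) λ ()
          split : ∀ h → bit (D h) ≡ bit (A h) + bit (B h)
          split h = lemma (D h) (A h) (A⊑D h)

        even : EvenEulerian (tabulate D)
        even = ≋⇒evenEulerian m m′ (tabulate D)
          (λ h → trans (cong (parity ∘ bit) (Vec.lookup∘tabulate D h)) (parity-bit-odd (lookup m h + lookup m′ h))) m≋m′

        -- Half the size of `D`, the degree of both terms of the binomial sought.
        r : ℕ
        r = _∣_.quotient (proj₂ even)

        ∣D∣≡r+r : ∑ (bit ∘ D) ≡ r + r
        ∣D∣≡r+r = begin
          ∑ (bit ∘ D)      ≡⟨ ∣tabulate∣ D ⟨
          ∣ tabulate D ∣   ≡⟨ _∣_.equality (proj₂ even) ⟩
          r * 2            ≡⟨ ℕ.*-comm r 2 ⟩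
          r + (r + 0)      ≡⟨ cong (r +_) (ℕ.+-identityʳ r) ⟩
          r + r            ∎
          where open ≡-Reasoning

        halve-≤ : ∀ {x} → r + r ≤ x + x → r ≤ x
        halve-≤ {x} p = ℕ.≮⇒≥ λ x<r → ℕ.<⇒≱ (ℕ.+-mono-< x<r x<r) p

        halve-< : ∀ {x} → r + r < x + x → r < x
        halve-< {x} p = ℕ.≰⇒> λ x≤r → ℕ.<⇒≱ p (ℕ.+-mono-≤ x≤r x≤r)

        A≤m : ∀ h → bit (A h) ≤ lookup m h
        A≤m h with D h | does (h Fin.≟ s)
        ... | false | _     = z≤n
        ... | true  | true  rewrite Bool.∧-zeroʳ (odd (lookup m h)) = z≤n
        ... | true  | false rewrite Bool.∧-identityʳ (odd (lookup m h)) = bit-odd≤ (lookup m h)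

        Reduction : Set
        Reduction = ∃₂ λ α β → IsEulerianPair α β × Grevlex ε β α × (∀ h → lookup α h ≤ lookup m h)

        -- Any `r` elements of `A′` serve as the leading half: they have odd exponent in `m`, so `α`
        -- divides `m`, and they avoid the last element of `D`, which therefore falls to `β`.
        halve : ∀ (A′ : Fin size → Bool) → A′ ⊑ A → r ≤ ∑ (bit ∘ A′) →
                ∀ {k} → D (ε ⟨$⟩ʳ k) ≡ true → A′ (ε ⟨$⟩ʳ k) ≡ false →
                (∀ j → k <ᶠ j → D (ε ⟨$⟩ʳ j) ≡ false) → Reduction
        halve A′ A′⊑A r≤ {k} Dk A′k D>k with S , S⊑A′ , ∣S∣≡r ← subset-of-size A′ r r≤ =
          tabulate (bit ∘ S) , tabulate (λ h → bit (D h ∧ not (S h))) ,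
          halving-eulerian D even S S⊑D half Dk Sk D>k ,
          halving-grevlex D even S S⊑D half Dk Sk D>k ,
          λ h → subst (_≤ lookup m h) (sym (Vec.lookup∘tabulate (bit ∘ S) h)) (S≤m h)
          where
          S⊑D : S ⊑ D
          S⊑D h = A⊑D h ∘ A′⊑A h ∘ S⊑A′ h
          half : ∑ (bit ∘ D) ≡ ∑ (bit ∘ S) + ∑ (bit ∘ S)
          half = trans ∣D∣≡r+r (sym (cong₂ _+_ ∣S∣≡r ∣S∣≡r))
          Sk : S (ε ⟨$⟩ʳ k) ≡ false
          Sk = Bool.¬-not λ Sk → contradiction (trans (sym A′k) (S⊑A′ _ Sk)) λ ()
          S≤m : ∀ h → bit (S h) ≤ lookup m h
          S≤m h with S h in eq
          ... | false = z≤n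
          ... | true  = subst (λ b → bit b ≤ lookup m h) (A′⊑A h (S⊑A′ h eq)) (A≤m h)

      -- If k ∈ B, it is the last element of D. Otherwise the inequality balance is strict at k,
      -- which leaves room to drop the last element of D from A.
      halving-reduction : Reduction
      halving-reduction with B (ε ⟨$⟩ʳ k) in Bk
      -- Beyond `k` the exponents of `m` and `m′` agree, so their sums are even and no edge there is
      -- in `D`.
      ... | true = halve A (λ _ p → p) (halve-≤ r+r≤) (∧-trueˡ Bk) (not-true (∧-trueʳ (D (ε ⟨$⟩ʳ k)) Bk))
                     λ j k<j → trans (cong (λ x → odd (lookup m (ε ⟨$⟩ʳ j) + x)) (m>k j k<j))
                                     (odd-even (lookup m (ε ⟨$⟩ʳ j) + lookup m (ε ⟨$⟩ʳ j)) (parity-double (lookup m (ε ⟨$⟩ʳ j))))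
        where
        r+r≤ : r + r ≤ ∑ (bit ∘ A) + ∑ (bit ∘ A)
        r+r≤ = ℕ.≤-trans (ℕ.≤-reflexive (trans (sym ∣D∣≡r+r) ∣D∣≡∣A∣+∣B∣)) (ℕ.+-monoʳ-≤ _ ∣B∣≤∣A∣)
        ∧-trueʳ : ∀ a {b} → a ∧ b ≡ true → b ≡ true
        ∧-trueʳ true p = p
        not-true : ∀ {b} → not b ≡ true → b ≡ false
        not-true {false} _ = refl
      ... | false =
        -- Here `k` itself may lie outside `D`, so the last element `k₀` is searched for. As `r` is
        -- strictly below the size of `A`, at least `r` candidates survive its removal.
        halve (A without (ε ⟨$⟩ʳ k₀)) (λ _ → ∧-trueˡ)
          (ℕ.≤-pred (ℕ.≤-trans (halve-< r+r<) (∑-without A (ε ⟨$⟩ʳ k₀))))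
          (proj₁ (proj₂ last-D)) (without-self A (ε ⟨$⟩ʳ k₀))
          (λ j k₀<j → Bool.¬-not (proj₂ (proj₂ last-D) j k₀<j))
        where
        r+r< : r + r < ∑ (bit ∘ A) + ∑ (bit ∘ A)
        r+r< = ℕ.≤-<-trans (ℕ.≤-reflexive (trans (sym ∣D∣≡r+r) ∣D∣≡∣A∣+∣B∣)) (ℕ.+-monoʳ-< _ (∣B∣<∣A∣ Bk))
        bit>0 : ∀ {b} → 0 < bit b → b ≡ true
        bit>0 {true} _ = refl
        nonempty : ∃[ j ] D (ε ⟨$⟩ʳ j) ≡ true
        -- `A` has more elements than `B`, hence at least one; `ε ⟨$⟩ˡ h` is the position of that
        -- edge in the variable order.
        nonempty with h , 0<Ah ← ∑>0⇒∃>0 (ℕ.≤-<-trans z≤n (∣B∣<∣A∣ Bk)) =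
          ε ⟨$⟩ˡ h , trans (cong D (inverseʳ ε)) (A⊑D h (bit>0 0<Ah))
        last-D : ∃[ k ] (D (ε ⟨$⟩ʳ k) ≡ true × (∀ j → k <ᶠ j → D (ε ⟨$⟩ʳ j) ≢ true))
        last-D = last (λ j → D (ε ⟨$⟩ʳ j) Bool.≟ true) nonempty
        k₀ : Fin size
        k₀ = proj₁ last-D

    -- The combinatorial core, stated for exponent vectors alone; `smaller⇒monomial∈Initial` carries
    -- it over to polynomials.
    reduction : ∀ {m m′} → m ≋ m′ → Grevlex ε m′ m →
                ∃₂ λ α β → ((∃₂ λ h l → α ≡ square h × β ≡ square l) ⊎ IsEulerianPair α β) ×
                           Grevlex ε β α × (∀ h → lookup α h ≤ lookup m h)
    reduction (deg , _) (inj₁ deg<) = contradiction (sym deg) (ℕ.<⇒≢ deg<)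
    reduction {m} {m′} m≋m′ (inj₂ (_ , k , mk<m′k , m>k))
      -- For the predicate that always holds, `last` returns the largest index, the position of the
      -- smallest variable; `k` witnesses that there is an index.
      with ℓ , _ , last-ℓ ← last (λ _ → yes tt) (k , tt)
      with Fin.any? (λ h → ¬? (h Fin.≟ ε ⟨$⟩ʳ ℓ) ×-dec (2 ℕ.≤? lookup m h))
    ... | yes (h , h≢s , 2≤mh) =
      square h , square (ε ⟨$⟩ʳ ℓ) , inj₁ (h , _ , refl , refl) ,
      grevlex-square (λ j ℓ<j → last-ℓ j ℓ<j tt) h≢s , square-≤ {m} 2≤mh
    ... | no ∄ =
      let α , β , pair , β≺α , α≤m = halving-reduction m m′ m≋m′ (λ j ℓ<j → last-ℓ j ℓ<j tt) mk<m′k m>k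
            (λ h h≢s → ℕ.≮⇒≥ λ 2≤mh → ∄ (h , h≢s , 2≤mh))
      in α , β , inj₂ pair , β≺α , α≤m


-- Induction on monomials, and their powers and products

_≟ᵐ_ : DecidableEquality (Monomial n)
_≟ᵐ_ = Vec.≡-dec ℕ._≟_

monomial-induction : ∀ {ℓ} (P : Pred (Monomial n) ℓ) → P 𝟏 →
                     (∀ i α → P α → P (unit i · α)) → ∀ α → P α
monomial-induction {zero}  P P𝟏 step []      = P𝟏
monomial-induction {suc n} P P𝟏 step (x ∷ α) = times x
  where
  times : ∀ x → P (x ∷ α)
  times zero    = monomial-induction (P ∘ (0 ∷_)) P𝟏 (λ i α → step (suc i) (0 ∷ α)) α
  times (suc x) = subst (λ β → P (suc x ∷ β)) (·-identityˡ α) (step zero (x ∷ α) (times x))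

-- Gives `⊙` and `∏` the same recursion as `^` and `product` on polynomials, so that exponents of
-- powers and products are found term by term in `isMonomial-^` and `isMonomial-product`.
monomialRawMonoid : ℕ → RawMonoid _ _
monomialRawMonoid n = record { Carrier = Monomial n ; _≈_ = _≡_ ; _∙_ = _·_ ; ε = 𝟏 }

module _ {n : ℕ} where
  open RawMonoidOps (monomialRawMonoid n) public renaming (_×_ to _⊙_; sum to ∏) using ()

lookup-⊙ : ∀ k (α : Monomial n) i → lookup (k ⊙ α) i ≡ k * lookup α i
lookup-⊙ zero    α i = Vec.lookup-replicate i 0
lookup-⊙ (suc k) α i = trans (lookup-· α (k ⊙ α) i) (cong (lookup α i +_) (lookup-⊙ k α i))

lookup-∏ : ∀ {m} (t : Fin m → Monomial n) i → lookup (∏ t) i ≡ ∑ (λ h → lookup (t h) i)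
lookup-∏ {m = zero}  t i = Vec.lookup-replicate i 0
lookup-∏ {m = suc m} t i = trans (lookup-· (t zero) (∏ (t ∘ suc)) i) (cong (lookup (t zero) i +_) (lookup-∏ (t ∘ suc) i))

degree-⊙ : ∀ k (α : Monomial n) → degree (k ⊙ α) ≡ k * degree α
degree-⊙ {n} zero α = degree-𝟏 {n}
degree-⊙ (suc k) α = trans (degree-· α (k ⊙ α)) (cong (degree α +_) (degree-⊙ k α))

degree-∏ : ∀ {m} (t : Fin m → Monomial n) → degree (∏ t) ≡ ∑ (degree ∘ t)
degree-∏ {n} {zero}  t = degree-𝟏 {n}
degree-∏ {n} {suc m} t = trans (degree-· (t zero) (∏ (t ∘ suc))) (cong (degree (t zero) +_) (degree-∏ (t ∘ suc)))

-- Linear functionals and binomial ideals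

module PolynomialProperties {c ℓ₁ ℓ₂} (K : HeytingField c ℓ₁ ℓ₂) where
  open Polynomials K
  open HeytingField K using (heytingCommutativeRing; _#_; #-irrefl; #-cotrans; #⇒invertible)
  open HeytingCommutativeRing heytingCommutativeRing using (commutativeRing)
  module K = CommutativeRing commutativeRing
  open HeytingProperties heytingCommutativeRing using (1#0; #-congʳ; invertibleˡ⇒#; x-0≈x)
  open RingProperties K.ring using (-‿+-comm; -1*x≈-x; -‿involutive)
  open CommutativeSemigroupProperties (CommutativeMonoid.commutativeSemigroup K.+-commutativeMonoid)
    using () renaming (interchange to K-interchange)
  open K using (Carrier; 0#; 1#)
  open SetoidReasoning K.setoid

  private variable
    w w′ : Monomial n → Carrier

  -- The linear functional on polynomials with the value `w m` at the monomial `m`.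
  extend : (Monomial n → Carrier) → Poly n → Carrier
  extend w []            = 0#
  extend w ((a , m) ∷ f) = a K.* w m K.+ extend w f

  δ : Monomial n → Monomial n → Carrier
  δ m m′ = if does (m′ ≟ᵐ m) then 1# else 0#

  δ-≡ : ∀ (m : Monomial n) → δ m m ≡ 1#
  δ-≡ m rewrite dec-true (m ≟ᵐ m) refl = refl

  δ-≢ : ∀ {m m′ : Monomial n} → m′ ≢ m → δ m m′ ≡ 0#
  δ-≢ {m = m} {m′} m′≢m rewrite dec-false (m′ ≟ᵐ m) m′≢m = refl

  coeff-∷ : ∀ a m′ (f : Poly n) m → coeff ((a , m′) ∷ f) m K.≈ a K.* δ m m′ K.+ coeff f m
  coeff-∷ a m′ f m with does (m′ ≟ᵐ m)
  ... | true  = K.+-congʳ (K.sym (K.*-identityʳ a))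
  ... | false = K.trans (K.sym (K.+-identityˡ _)) (K.+-congʳ (K.sym (K.zeroʳ a)))

  coeff≈extend-δ : ∀ (f : Poly n) m → coeff f m K.≈ extend (δ m) f
  coeff≈extend-δ []             m = K.refl
  coeff≈extend-δ ((a , m′) ∷ f) m = K.trans (coeff-∷ a m′ f m) (K.+-congˡ (coeff≈extend-δ f m))

  -- Coefficients are the functionals with weights `δ m`. Testing against all functionals avoids
  -- deciding equality of monomials in every polynomial identity below.
  ≈-by-extend : ∀ (f g : Poly n) → (∀ w → extend w f K.≈ extend w g) → f ≈ g
  ≈-by-extend f g eq m = K.trans (coeff≈extend-δ f m) (K.trans (eq (δ m)) (K.sym (coeff≈extend-δ g m)))

  extend-cong : ∀ (f : Poly n) → (∀ m → w m K.≈ w′ m) → extend w f K.≈ extend w′ f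
  extend-cong []            eq = K.refl
  extend-cong ((a , m) ∷ f) eq = K.+-cong (K.*-congˡ (eq m)) (extend-cong f eq)

  extend-0 : ∀ (f : Poly n) → extend (λ _ → 0#) f K.≈ 0#
  extend-0 []            = K.refl
  extend-0 ((a , m) ∷ f) = K.trans (K.+-cong (K.zeroʳ a) (extend-0 f)) (K.+-identityʳ 0#)

  extend-+ : ∀ (w w′ : Monomial n → Carrier) f →
             extend (λ m → w m K.+ w′ m) f K.≈ extend w f K.+ extend w′ f
  extend-+ w w′ []            = K.sym (K.+-identityʳ 0#)
  extend-+ w w′ ((a , m) ∷ f) =
    K.trans (K.+-cong (K.distribˡ a _ _) (extend-+ w w′ f)) (K-interchange _ _ _ _)

  extend-⊕ : ∀ (w : Monomial n → Carrier) f g → extend w (f ⊕ g) K.≈ extend w f K.+ extend w g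
  extend-⊕ w []            g = K.sym (K.+-identityˡ _)
  extend-⊕ w ((a , m) ∷ f) g = K.trans (K.+-congˡ (extend-⊕ w f g)) (K.sym (K.+-assoc _ _ _))

  extend-⊗ : ∀ (w : Monomial n → Carrier) f g →
             extend w (f ⊗ g) K.≈ extend (λ α → extend (λ β → w (α · β)) g) f
  extend-⊗ w []            g = K.refl
  extend-⊗ w ((a , α) ∷ f) g =
    K.trans (extend-⊕ w (map (λ (b , β) → a K.* b , α · β) g) (f ⊗ g)) (K.+-cong (scale g) (extend-⊗ w f g))
    where
    scale : ∀ g → extend w (map (λ (b , β) → a K.* b , α · β) g) K.≈ a K.* extend (λ β → w (α · β)) g
    scale []            = K.sym (K.zeroʳ a)
    scale ((b , β) ∷ g) =
      K.trans (K.+-cong (K.*-assoc a b _) (scale g)) (K.sym (K.distribˡ a _ _))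

  binomial : Monomial n → Monomial n → Poly n
  binomial α β = monomial α ⊖ monomial β

  extend-binomial : ∀ (w : Monomial n → Carrier) α β →
                    extend w (binomial α β) K.≈ w α K.- w β
  extend-binomial w α β = K.+-cong (K.*-identityˡ (w α)) (K.trans (K.+-identityʳ _) (-1*x≈-x (w β)))

  extend-monomial : ∀ (w : Monomial n → Carrier) α → extend w (monomial α) K.≈ w α
  extend-monomial w α = K.trans (K.+-identityʳ _) (K.*-identityˡ (w α))

  private
    Σ[_] : (Monomial n → Carrier) → List (Monomial n) → Carrier
    Σ[ t ] []       = 0#
    Σ[ t ] (m ∷ ms) = t m K.+ Σ[ t ] ms

    Σ-cong : ∀ {t t′ : Monomial n → Carrier} ms → (∀ m → t m K.≈ t′ m) → Σ[ t ] ms K.≈ Σ[ t′ ] ms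
    Σ-cong []       eq = K.refl
    Σ-cong (m ∷ ms) eq = K.+-cong (eq m) (Σ-cong ms eq)

    Σ-+ : ∀ (t t′ : Monomial n → Carrier) ms →
          Σ[ (λ m → t m K.+ t′ m) ] ms K.≈ Σ[ t ] ms K.+ Σ[ t′ ] ms
    Σ-+ t t′ []       = K.sym (K.+-identityʳ 0#)
    Σ-+ t t′ (m ∷ ms) = K.trans (K.+-congˡ (Σ-+ t t′ ms)) (K-interchange _ _ _ _)

    Σ-δ-∉ : ∀ (a : Carrier) (w : Monomial n → Carrier) {m ms} → All (m ≢_) ms →
            Σ[ (λ m′ → a K.* δ m′ m K.* w m′) ] ms K.≈ 0#
    Σ-δ-∉ a w []                          = K.refl
    Σ-δ-∉ a w {m} {m′ ∷ ms} (m≢m′ ∷ m∉ms) = begin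
      a K.* δ m′ m K.* w m′ K.+ _ ≈⟨ K.+-cong (K.*-congʳ (K.*-congˡ (K.reflexive (δ-≢ m≢m′)))) (Σ-δ-∉ a w m∉ms) ⟩
      a K.* 0# K.* w m′ K.+ 0#    ≈⟨ K.+-identityʳ _ ⟩
      a K.* 0# K.* w m′           ≈⟨ K.*-congʳ (K.zeroʳ a) ⟩
      0# K.* w m′                 ≈⟨ K.zeroˡ _ ⟩
      0#                          ∎

    Σ-δ-∈ : ∀ (a : Carrier) (w : Monomial n → Carrier) {m ms} → Unique ms → m ∈ ms →
            Σ[ (λ m′ → a K.* δ m′ m K.* w m′) ] ms K.≈ a K.* w m
    Σ-δ-∈ a w {m} (m∉ms ∷ _) (here refl) = begin
      a K.* δ m m K.* w m K.+ _ ≈⟨ K.+-cong (K.*-congʳ (K.*-congˡ (K.reflexive (δ-≡ m)))) (Σ-δ-∉ a w m∉ms) ⟩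
      a K.* 1# K.* w m K.+ 0#   ≈⟨ K.+-identityʳ _ ⟩
      a K.* 1# K.* w m          ≈⟨ K.*-congʳ (K.*-identityʳ a) ⟩
      a K.* w m                 ∎
    Σ-δ-∈ a w {m} {m′ ∷ _} (m′∉ms ∷ unique) (there m∈ms) = begin
      a K.* δ m′ m K.* w m′ K.+ _       ≈⟨ K.+-cong (K.*-congʳ (K.*-congˡ (K.reflexive (δ-≢ m≢m′)))) (Σ-δ-∈ a w unique m∈ms) ⟩
      a K.* 0# K.* w m′ K.+ a K.* w m   ≈⟨ K.+-congʳ (K.trans (K.*-congʳ (K.zeroʳ a)) (K.zeroˡ _)) ⟩
      0# K.+ a K.* w m                  ≈⟨ K.+-identityˡ _ ⟩
      a K.* w m                         ∎
      where
      m≢m′ : m ≢ m′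
      m≢m′ m≡m′ = All.lookup m′∉ms m∈ms (sym m≡m′)

    -- Collects equal monomials of a formal sum. A repetition in `ms` would count a coefficient
    -- twice, hence `Unique`; `ms` may contain monomials foreign to `f`, so that two polynomials can
    -- share one list.
    extend≈Σ : ∀ (w : Monomial n → Carrier) f {ms} → Unique ms → All (λ t → proj₂ t ∈ ms) f →
               extend w f K.≈ Σ[ (λ m → coeff f m K.* w m) ] ms
    extend≈Σ w [] {ms} _ _ = K.sym (zeros ms)
      where
      zeros : ∀ ms → Σ[ (λ m → 0# K.* w m) ] ms K.≈ 0#
      zeros []       = K.refl
      zeros (m ∷ ms) = K.trans (K.+-cong (K.zeroˡ _) (zeros ms)) (K.+-identityʳ 0#)
    extend≈Σ w ((a , m) ∷ f) {ms} unique (m∈ms ∷ f⊆ms) = begin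
      a K.* w m K.+ extend w f
        ≈⟨ K.+-cong (Σ-δ-∈ a w unique m∈ms) (K.sym (extend≈Σ w f unique f⊆ms)) ⟨
      Σ[ (λ m′ → a K.* δ m′ m K.* w m′) ] ms K.+ Σ[ (λ m′ → coeff f m′ K.* w m′) ] ms
        ≈⟨ Σ-+ _ _ ms ⟨
      Σ[ (λ m′ → a K.* δ m′ m K.* w m′ K.+ coeff f m′ K.* w m′) ] ms
        ≈⟨ Σ-cong ms (λ m′ → K.trans (K.*-congʳ (coeff-∷ a m f m′)) (K.distribʳ (w m′) _ _)) ⟨
      Σ[ (λ m′ → coeff ((a , m) ∷ f) m′ K.* w m′) ] ms ∎

    monomials : Poly n → List (Monomial n)
    monomials f = deduplicate _≟ᵐ_ (map proj₂ f)

    monomials-unique : ∀ (f : Poly n) → Unique (monomials f)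
    monomials-unique f = deduplicate-! _≟ᵐ_ (map proj₂ f)

    monomials-⊇ : ∀ (f : Poly n) → All (λ t → proj₂ t ∈ monomials f) f
    monomials-⊇ f = All.tabulate λ t∈f → ∈-deduplicate⁺ _≟ᵐ_ (∈-map⁺ proj₂ t∈f)

  -- `extend` reads the terms as written, whereas `≈` compares coefficients. Collecting both sums
  -- along the monomials of `f ++ g` leaves only coefficients.
  extend-≈ : ∀ (w : Monomial n → Carrier) f g → f ≈ g → extend w f K.≈ extend w g
  extend-≈ w f g f≈g = begin
    extend w f                        ≈⟨ extend≈Σ w f (monomials-unique (f ++ g)) (All.tabulate (All.lookup ⊇ ∘ ∈-++⁺ˡ)) ⟩
    Σ[ (λ m → coeff f m K.* w m) ] ms ≈⟨ Σ-cong ms (λ m → K.*-congʳ (f≈g m)) ⟩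
    Σ[ (λ m → coeff g m K.* w m) ] ms ≈⟨ extend≈Σ w g (monomials-unique (f ++ g)) (All.tabulate (All.lookup ⊇ ∘ ∈-++⁺ʳ f)) ⟨
    extend w g                        ∎
    where
    ms = monomials (f ++ g)
    ⊇  = monomials-⊇ (f ++ g)

  -- By cotransitivity the sum is apart from `y`, or `y` is apart from 0. In the first case the
  -- difference of the sum and `y`, which is `x`, is invertible.
  x+y#0 : ∀ {x y} → x K.+ y # 0# → x # 0# ⊎ y # 0#
  x+y#0 {x} {y} x+y#0 with #-cotrans x+y#0 y
  ... | inj₂ y#0   = inj₂ y#0
  ... | inj₁ x+y#y with z , z*≈1 , _ ← #⇒invertible x+y#y = inj₁ (invertibleˡ⇒# (z , (begin
    z K.* (x K.- 0#)         ≈⟨ K.*-congˡ (x-0≈x x) ⟩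
    z K.* x                  ≈⟨ K.*-congˡ (K.+-identityʳ x) ⟨
    z K.* (x K.+ 0#)         ≈⟨ K.*-congˡ (K.+-congˡ (K.-‿inverseʳ y)) ⟨
    z K.* (x K.+ (y K.- y))  ≈⟨ K.*-congˡ (K.+-assoc x y _) ⟨
    z K.* ((x K.+ y) K.- y)  ≈⟨ z*≈1 ⟩
    1#                       ∎)))

  xy#0⇒y#0 : ∀ {x y} → x K.* y # 0# → y # 0#
  xy#0⇒y#0 {x} {y} xy#0 with z , z*≈1 , _ ← #⇒invertible xy#0 = invertibleˡ⇒# (z K.* x , (begin
    z K.* x K.* (y K.- 0#)   ≈⟨ K.*-congˡ (x-0≈x y) ⟩
    z K.* x K.* y            ≈⟨ K.*-assoc z x y ⟩
    z K.* (x K.* y)          ≈⟨ K.*-congˡ (x-0≈x _) ⟨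
    z K.* (x K.* y K.- 0#)   ≈⟨ z*≈1 ⟩
    1#                       ∎))

  -- The value is a finite sum of products, so `x+y#0` locates a summand apart from 0, and both of
  -- its factors are then apart from 0.
  extend-# : ∀ (w : Monomial n → Carrier) f → extend w f # 0# → ∃[ m ] (coeff f m # 0# × w m # 0#)
  extend-# w f ≢0 = search (monomials f) (#-congʳ (extend≈Σ w f (monomials-unique f) (monomials-⊇ f)) ≢0)
    where
    search : ∀ ms → Σ[ (λ m → coeff f m K.* w m) ] ms # 0# → ∃[ m ] (coeff f m # 0# × w m # 0#)
    search []       0#0 = contradiction 0#0 (#-irrefl K.refl)
    search (m ∷ ms) p with x+y#0 p
    ... | inj₁ q = m , xy#0⇒y#0 (#-congʳ (K.*-comm _ _) q) , xy#0⇒y#0 q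
    ... | inj₂ q = search ms q

  coeff-binomial : ∀ (f : Poly n) α β → f ≈ binomial α β → ∀ m → coeff f m K.≈ δ m α K.- δ m β
  coeff-binomial f α β f≈ m = K.trans (f≈ m)
    (K.trans (coeff≈extend-δ (binomial α β) m) (extend-binomial (δ m) α β))

  leadingMonomial-binomial : ∀ {ℓ} {_≺_ : Monomial n → Monomial n → Set ℓ} {f α β} → α ≢ β → β ≺ α →
                             f ≈ binomial α β → IsLeadingMonomial _≺_ f α
  leadingMonomial-binomial {f = f} {α} {β} α≢β β≺α f≈ = #-congʳ (K.sym coeff≈1) 1#0 , lower
    where
    coeff≈1 : coeff f α K.≈ 1#
    coeff≈1 = begin
      coeff f α           ≈⟨ coeff-binomial f α β f≈ α ⟩
      δ α α K.- δ α β     ≡⟨ cong₂ K._-_ (δ-≡ α) (δ-≢ (α≢β ∘ sym)) ⟩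
      1# K.- 0#           ≈⟨ x-0≈x 1# ⟩
      1#                  ∎
    lower : ∀ m → coeff f m # 0# → m ≡ α ⊎ _
    lower m fm#0 with m ≟ᵐ α | m ≟ᵐ β
    ... | yes m≡α | _        = inj₁ m≡α
    ... | no _    | yes refl = inj₂ β≺α
    ... | no m≢α  | no m≢β   = contradiction fm#0 (#-irrefl (begin
      coeff f m           ≈⟨ coeff-binomial f α β f≈ m ⟩
      δ m α K.- δ m β     ≡⟨ cong₂ K._-_ (δ-≢ (m≢α ∘ sym)) (δ-≢ (m≢β ∘ sym)) ⟩
      0# K.- 0#           ≈⟨ x-0≈x 0# ⟩
      0#                  ∎))

  ⟨⟩-least : ∀ {ℓ ℓ′} {S : Pred (Poly n) ℓ} {T : Pred (Poly n) ℓ′} → S ⊆ ⟨ T ⟩ → ⟨ S ⟩ ⊆ ⟨ T ⟩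
  ⟨⟩-least S⊆ (generator f∈)   = S⊆ f∈
  ⟨⟩-least S⊆ zero             = zero
  ⟨⟩-least S⊆ (add f∈ g∈)      = add (⟨⟩-least S⊆ f∈) (⟨⟩-least S⊆ g∈)
  ⟨⟩-least S⊆ (multiply f g∈)  = multiply f (⟨⟩-least S⊆ g∈)
  ⟨⟩-least S⊆ (respects eq f∈) = respects eq (⟨⟩-least S⊆ f∈)

  ⟨⟩-monomial-∣ : ∀ {ℓ} {S : Pred (Poly n) ℓ} {α β} → (∀ i → lookup α i ≤ lookup β i) →
                  ⟨ S ⟩ (monomial α) → ⟨ S ⟩ (monomial β)
  ⟨⟩-monomial-∣ {α = α} {β} α≤β α∈ = respects eq (multiply (monomial γ) α∈)
    where
    -- The cofactor: truncated subtraction is exact here because `α` divides `β`.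
    γ = zipWith _∸_ β α
    γα≡β : γ · α ≡ β
    γα≡β = lookup-injective λ i → trans (lookup-· γ α i)
      (trans (cong (_+ lookup α i) (Vec.lookup-zipWith _∸_ i β α)) (ℕ.m∸n+n≡m (α≤β i)))
    eq : monomial γ ⊗ monomial α ≈ monomial β
    eq = ≈-by-extend (monomial γ ⊗ monomial α) (monomial β) λ w → begin
      extend w (monomial γ ⊗ monomial α) ≈⟨ extend-⊗ w (monomial γ) (monomial α) ⟩
      extend (λ μ → extend (λ ν → w (μ · ν)) (monomial α)) (monomial γ) ≈⟨ extend-monomial (λ μ → extend (λ ν → w (μ · ν)) (monomial α)) γ ⟩
      extend (λ ν → w (γ · ν)) (monomial α) ≈⟨ extend-monomial (λ ν → w (γ · ν)) α ⟩
      w (γ · α) ≡⟨ cong w γα≡β ⟩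
      w β ≈⟨ extend-monomial w β ⟨
      extend w (monomial β) ∎

  module _ {ℓ} (S : Pred (Poly n) ℓ) where

    infix 4 _∼_
    _∼_ : Monomial n → Monomial n → Set _
    α ∼ β = ⟨ S ⟩ (binomial α β)

    ∼-refl : ∀ {α} → α ∼ α
    ∼-refl {α} = respects (≈-by-extend [] (binomial α α) λ w →
      K.sym (K.trans (extend-binomial w α α) (K.-‿inverseʳ (w α)))) zero

    ∼-trans : ∀ {α β γ} → α ∼ β → β ∼ γ → α ∼ γ
    ∼-trans {α} {β} {γ} α∼β β∼γ = respects (≈-by-extend p (binomial α γ) eq) (add α∼β β∼γ)
      where
      p = (binomial α β) ⊕ (binomial β γ)
      eq : ∀ w → extend w p K.≈ extend w (binomial α γ)
      eq w = begin
        extend w p ≈⟨ extend-⊕ w (binomial α β) (binomial β γ) ⟩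
        extend w (binomial α β) K.+ extend w (binomial β γ)
          ≈⟨ K.+-cong (extend-binomial w α β) (extend-binomial w β γ) ⟩
        (w α K.- w β) K.+ (w β K.- w γ) ≈⟨ K.+-assoc (w α) _ _ ⟩
        w α K.+ (K.- w β K.+ (w β K.- w γ)) ≈⟨ K.+-congˡ (K.+-assoc _ (w β) _) ⟨
        w α K.+ ((K.- w β K.+ w β) K.- w γ) ≈⟨ K.+-congˡ (K.+-congʳ (K.-‿inverseˡ (w β))) ⟩
        w α K.+ (0# K.- w γ) ≈⟨ K.+-congˡ (K.+-identityˡ _) ⟩
        w α K.- w γ ≈⟨ extend-binomial w α γ ⟨
        extend w (binomial α γ) ∎

    ∼-· : ∀ μ {α β} → α ∼ β → μ · α ∼ μ · β
    ∼-· μ {α} {β} α∼β = respects (≈-by-extend p (binomial (μ · α) (μ · β)) eq) (multiply (monomial μ) α∼β)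
      where
      p = monomial μ ⊗ (binomial α β)
      eq : ∀ w → extend w p K.≈ extend w (binomial (μ · α) (μ · β))
      eq w = begin
        extend w p ≈⟨ extend-⊗ w (monomial μ) (binomial α β) ⟩
        extend (λ μ → extend (λ ν → w (μ · ν)) (binomial α β)) (monomial μ) ≈⟨ extend-monomial (λ μ → extend (λ ν → w (μ · ν)) (binomial α β)) μ ⟩
        extend (λ ν → w (μ · ν)) (binomial α β) ≈⟨ extend-binomial (λ ν → w (μ · ν)) α β ⟩
        w (μ · α) K.- w (μ · β) ≈⟨ extend-binomial w (μ · α) (μ · β) ⟨
        extend w (binomial (μ · α) (μ · β)) ∎

    ∼-sym : ∀ {α β} → α ∼ β → β ∼ α
    ∼-sym {α} {β} α∼β = respects (≈-by-extend p (binomial β α) eq) (multiply (const (K.- 1#)) α∼β)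
      where
      p = const (K.- 1#) ⊗ (binomial α β)
      eq : ∀ w → extend w p K.≈ extend w (binomial β α)
      eq w = begin
        extend w p ≈⟨ extend-⊗ w (const (K.- 1#)) (binomial α β) ⟩
        (K.- 1#) K.* extend (λ ν → w (𝟏 · ν)) (binomial α β) K.+ 0# ≈⟨ K.+-identityʳ _ ⟩
        (K.- 1#) K.* extend (λ ν → w (𝟏 · ν)) (binomial α β) ≈⟨ -1*x≈-x _ ⟩
        K.- extend (λ ν → w (𝟏 · ν)) (binomial α β) ≈⟨ K.-‿cong (extend-binomial (λ ν → w (𝟏 · ν)) α β) ⟩
        K.- (w (𝟏 · α) K.- w (𝟏 · β)) ≡⟨ cong₂ (λ x y → K.- (w x K.- w y)) (·-identityˡ α) (·-identityˡ β) ⟩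
        K.- (w α K.- w β) ≈⟨ -‿+-comm (w α) _ ⟨
        K.- w α K.- K.- w β ≈⟨ K.+-congˡ (-‿involutive (w β)) ⟩
        K.- w α K.+ w β ≈⟨ K.+-comm _ _ ⟩
        w β K.- w α ≈⟨ extend-binomial w β α ⟨
        extend w (binomial β α) ∎


-- Degree and parities are a complete set of invariants of monomials modulo (xᵢ² - xⱼ²).
infix 4 _≃_
_≃_ : Rel (Monomial n) _
γ ≃ γ′ = degree γ ≡ degree γ′ × (∀ v → parity (lookup γ v) ≡ parity (lookup γ′ v))

_≃?_ : ∀ (γ γ′ : Monomial n) → Dec (γ ≃ γ′)
γ ≃? γ′ = (degree γ ℕ.≟ degree γ′) ×-dec Fin.all? (λ v → parity (lookup γ v) ℙ.≟ parity (lookup γ′ v))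

≃-sym : {γ γ′ : Monomial n} → γ ≃ γ′ → γ′ ≃ γ
≃-sym (deg , par) = sym deg , sym ∘ par

≃-trans : {γ γ′ γ″ : Monomial n} → γ ≃ γ′ → γ′ ≃ γ″ → γ ≃ γ″
≃-trans (deg , par) (deg′ , par′) = trans deg deg′ , λ v → trans (par v) (par′ v)

≃-· : ∀ (μ : Monomial n) {γ γ′} → γ ≃ γ′ → μ · γ ≃ μ · γ′
≃-· μ {γ} {γ′} (deg , par) =
  trans (degree-· μ γ) (trans (cong (degree μ +_) deg) (sym (degree-· μ γ′))) ,
  λ v → trans (parity-lookup v γ) (trans (cong (parity (lookup μ v) +ℙ_) (par v)) (sym (parity-lookup v γ′)))
  where
  parity-lookup : ∀ v γ → parity (lookup (μ · γ) v) ≡ parity (lookup μ v) +ℙ parity (lookup γ v)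
  parity-lookup v γ = trans (cong parity (lookup-· μ γ v)) (ℙ.+-homo-+ (lookup μ v) (lookup γ v))

square-≃ : ∀ (i j : Fin n) → square i ≃ square j
square-≃ i j = trans (degree-square i) (sym (degree-square j)) , λ v → trans (even i v) (sym (even j v))
  where
  even : ∀ i v → parity (lookup (square i) v) ≡ _
  even i v = trans (cong parity (lookup-square i v)) (parity-double (lookup (unit i) v))

-- A monomial is a square-free monomial times a square. The class under `≃` determines the
-- square-free factor and the degree of the square root, which is all that survives modulo the
-- squares.
oddPart halfPart : Monomial n → Monomial n
oddPart  = Vec.map (bit ∘ odd)
halfPart = Vec.map ⌊_/2⌋

odd-half-split : ∀ (γ : Monomial n) → γ ≡ oddPart γ · (halfPart γ · halfPart γ)
odd-half-split []      = refl
odd-half-split (x ∷ γ) = cong₂ _∷_ (odd-halves x) (odd-half-split γ)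

≃⇒oddPart≡ : ∀ (γ γ′ : Monomial n) → γ ≃ γ′ → oddPart γ ≡ oddPart γ′
≃⇒oddPart≡ γ γ′ (_ , par) = lookup-injective λ v → begin
  lookup (oddPart γ) v   ≡⟨ Vec.lookup-map v (bit ∘ odd) γ ⟩
  bit (odd (lookup γ v)) ≡⟨ cong (λ p → bit (does (p ℙ.≟ _))) (par v) ⟩
  bit (odd (lookup γ′ v)) ≡⟨ Vec.lookup-map v (bit ∘ odd) γ′ ⟨
  lookup (oddPart γ′) v  ∎
  where open ≡-Reasoning

m+m-injective : ∀ {m n} → m + m ≡ n + n → m ≡ n
m+m-injective {m} {n} eq = trans (ℕ.n≡⌊n+n/2⌋ m) (trans (cong ⌊_/2⌋ eq) (sym (ℕ.n≡⌊n+n/2⌋ n)))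

≃⇒degree-halfPart≡ : ∀ (γ γ′ : Monomial n) → γ ≃ γ′ → degree (halfPart γ) ≡ degree (halfPart γ′)
≃⇒degree-halfPart≡ γ γ′ γ≃γ′ = m+m-injective (ℕ.+-cancelˡ-≡ (degree (oddPart γ)) _ _ (begin
  degree (oddPart γ) + (degree (halfPart γ) + degree (halfPart γ))    ≡⟨ degree-split γ ⟨
  degree γ                                                            ≡⟨ proj₁ γ≃γ′ ⟩
  degree γ′                                                           ≡⟨ degree-split γ′ ⟩
  degree (oddPart γ′) + (degree (halfPart γ′) + degree (halfPart γ′)) ≡⟨ cong (λ α → degree α + (degree (halfPart γ′) + degree (halfPart γ′))) (≃⇒oddPart≡ γ γ′ γ≃γ′) ⟨
  degree (oddPart γ) + (degree (halfPart γ′) + degree (halfPart γ′))  ∎))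
  where
  open ≡-Reasoning
  degree-split : ∀ γ → degree γ ≡ degree (oddPart γ) + (degree (halfPart γ) + degree (halfPart γ))
  degree-split γ = trans (cong degree (odd-half-split γ)) (trans (degree-· (oddPart γ) _)
    (cong (degree (oddPart γ) +_) (degree-· (halfPart γ) (halfPart γ))))

-- Both terms of an Eulerian binomial occur here, which bounds the search in `𝓣∪𝓔-finite`.
squareFreeMonomials : ∀ n → List (Monomial n)
squareFreeMonomials zero    = [] ∷ []
squareFreeMonomials (suc n) = cartesianProductWith _∷_ (0 ∷ 1 ∷ []) (squareFreeMonomials n)

∈-squareFreeMonomials : ∀ {n} (α : Monomial n) → (∀ i → lookup α i ≤ 1) → α ∈ squareFreeMonomials n
∈-squareFreeMonomials []      _   = here refl
∈-squareFreeMonomials (x ∷ α) α≤1 =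
  ∈-cartesianProductWith⁺ _∷_ (x∈ (α≤1 zero)) (∈-squareFreeMonomials α (α≤1 ∘ suc))
  where
  x∈ : ∀ {x} → x ≤ 1 → x ∈ 0 ∷ 1 ∷ []
  x∈ z≤n       = here refl
  x∈ (s≤s z≤n) = there (here refl)

-- The ideal generated by the differences of squares of variables

module SquareIdeal {c ℓ₁ ℓ₂} (K : HeytingField c ℓ₁ ℓ₂) where
  open Polynomials K
  open PolynomialProperties K
  open K using (Carrier; 0#; 1#)
  open SetoidReasoning K.setoid

  -- Repeats the generators used in `EulerianIdeal`, so that the two ideals agree by definition.
  SquareDifference : Pred (Poly n) _
  SquareDifference f = ∃₂ λ i j → f ≈ var i ^ 2 ⊖ var j ^ 2

  squareDifference≈binomial : ∀ (i j : Fin n) → var i ^ 2 ⊖ var j ^ 2 ≈ binomial (square i) (square j)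
  squareDifference≈binomial i j = ≈-by-extend (var i ^ 2 ⊖ var j ^ 2) (binomial (square i) (square j)) λ w →
    K.+-cong (K.*-congʳ 1*1*1) (K.+-congʳ (K.*-congʳ (K.-‿cong 1*1*1)))
    where
    1*1*1 : 1# K.* (1# K.* 1#) K.≈ 1#
    1*1*1 = K.trans (K.*-identityˡ _) (K.*-identityˡ 1#)

  Invariant : (Monomial n → Carrier) → Set _
  Invariant w = ∀ γ γ′ → γ ≃ γ′ → w γ K.≈ w γ′

  extend-⟨squares⟩ : ∀ {w : Monomial n → Carrier} {f} → Invariant w → ⟨ SquareDifference ⟩ f → extend w f K.≈ 0#
  extend-⟨squares⟩ {w = w} {f} inv (generator (i , j , f≈)) = begin
    extend w f                                ≈⟨ extend-≈ w f (binomial (square i) (square j)) (λ m → K.trans (f≈ m) (squareDifference≈binomial i j m)) ⟩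
    extend w (binomial (square i) (square j)) ≈⟨ extend-binomial w (square i) (square j) ⟩
    w (square i) K.- w (square j)             ≈⟨ K.+-congʳ (inv (square i) (square j) (square-≃ i j)) ⟩
    w (square j) K.- w (square j)             ≈⟨ K.-‿inverseʳ _ ⟩
    0#                                        ∎
  extend-⟨squares⟩ inv zero = K.refl
  extend-⟨squares⟩ {w = w} inv (add {f} {g} f∈ g∈) = K.trans (extend-⊕ w f g)
    (K.trans (K.+-cong (extend-⟨squares⟩ inv f∈) (extend-⟨squares⟩ inv g∈)) (K.+-identityʳ 0#))
  -- For each fixed `α` the weight shifted by `α` is again invariant, so the inner functional kills
  -- `g`.
  extend-⟨squares⟩ {w = w} inv (multiply f {g} g∈) = begin
    extend w (f ⊗ g)                              ≈⟨ extend-⊗ w f g ⟩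
    extend (λ α → extend (λ β → w (α · β)) g) f   ≈⟨ extend-cong f (λ α → extend-⟨squares⟩ (λ γ γ′ → inv (α · γ) (α · γ′) ∘ ≃-· α {γ} {γ′}) g∈) ⟩
    extend (λ _ → 0#) f                           ≈⟨ extend-0 f ⟩
    0#                                            ∎
  extend-⟨squares⟩ {w = w} inv (respects {f} {g} f≈g f∈) =
    K.trans (K.sym (extend-≈ w f g f≈g)) (extend-⟨squares⟩ inv f∈)

  private
    _≈ₛ_ : Rel (Monomial n) _
    _≈ₛ_ = _∼_ SquareDifference

    ∼-square : ∀ (i j : Fin n) → square i ≈ₛ square j
    ∼-square i j = generator (i , j , λ m → K.sym (squareDifference≈binomial i j m))

    -- Each squared variable is exchanged for the square of the variable `zero`, one at a time, so
    -- only the degree of `γ` is remembered.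
    ∼-double : ∀ (γ : Monomial (suc n)) → (γ · γ) ≈ₛ (degree γ ⊙ square zero)
    ∼-double {n} = monomial-induction P base step
      where
      P : Pred (Monomial (suc n)) _
      P γ = (γ · γ) ≈ₛ (degree γ ⊙ square zero)
      base : P 𝟏
      base = subst₂ _≈ₛ_ (sym (·-identityˡ 𝟏)) (cong (_⊙ square zero) (sym (degree-𝟏 {n}))) (∼-refl SquareDifference)
      step : ∀ i γ → P γ → P (unit i · γ)
      step i γ Pγ = subst₂ _≈ₛ_ lhs rhs
        (∼-trans SquareDifference
          (subst₂ _≈ₛ_ (·-comm (γ · γ) (square i)) (·-comm (γ · γ) (square zero))
            (∼-· SquareDifference (γ · γ) (∼-square i zero)))
          (∼-· SquareDifference (square zero) Pγ))
        where
        lhs : square i · (γ · γ) ≡ (unit i · γ) · (unit i · γ)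
        lhs = lookup-injective λ v → let u = lookup (unit i) v ; x = lookup γ v in trans
          (trans (lookup-· (square i) (γ · γ) v) (cong₂ _+_ (lookup-square i v) (lookup-· γ γ v)))
          (trans (+-interchange u u x x)
            (sym (trans (lookup-· (unit i · γ) (unit i · γ) v) (cong₂ _+_ (lookup-· (unit i) γ v) (lookup-· (unit i) γ v)))))
        rhs : square zero · (degree γ ⊙ square zero) ≡ degree (unit i · γ) ⊙ square zero
        rhs = cong (_⊙ square zero) (sym (trans (degree-· (unit i) γ) (cong (_+ degree γ) (degree-unit i))))

  -- Both monomials are congruent to one normal form, the odd part times a power of `square zero`,
  -- which depends only on the class. Without variables there is a single monomial.
  ≃⇒∼ : ∀ {γ γ′ : Monomial n} → γ ≃ γ′ → _∼_ SquareDifference γ γ′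
  ≃⇒∼ {zero}  {[]} {[]} _ = ∼-refl SquareDifference
  ≃⇒∼ {suc n} {γ} {γ′} γ≃γ′ = ∼-trans SquareDifference (normal γ) (∼-sym SquareDifference
    (subst (γ′ ≈ₛ_) (cong₂ (λ o d → o · (d ⊙ square zero)) (sym (≃⇒oddPart≡ γ γ′ γ≃γ′)) (sym (≃⇒degree-halfPart≡ γ γ′ γ≃γ′))) (normal γ′)))
    where
    normal : ∀ γ → γ ≈ₛ (oddPart γ · (degree (halfPart γ) ⊙ square zero))
    normal γ = subst (_≈ₛ (oddPart γ · (degree (halfPart γ) ⊙ square zero))) (sym (odd-half-split γ))
      (∼-· SquareDifference (oddPart γ) (∼-double (halfPart γ)))


-- The Eulerian ideal

module GröbnerBasis {c ℓ₁ ℓ₂} (K : HeytingField c ℓ₁ ℓ₂) (G : Graph) where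
  open ParityClasses K G
  open Polynomials K
  open PolynomialProperties K
  open SquareIdeal K
  open HeytingField K using (heytingCommutativeRing; _#_; #-irrefl)
  open HeytingProperties heytingCommutativeRing using (#-congʳ)
  open RingProperties K.ring using (-1*x≈-x)
  open K using (Carrier; 0#; 1#)
  open Graph G
  open Eulerian K G
  open SetoidReasoning K.setoid

  endpoints : Fin size → Monomial order
  endpoints h = unit (proj₁ (ends h)) · unit (proj₂ (ends h))

  -- The exponent vector of the image of a monomial under `φ`, as `isMonomial-φ` confirms.
  ∂ : Monomial size → Monomial order
  ∂ α = ∏ (λ h → lookup α h ⊙ endpoints h)

  -- The two ends of an edge differ by `ends-ordered`, so no exponent reaches 2.
  lookup-endpoints : ∀ h v → lookup (endpoints h) v ≡ bit (lookup (edge h) v)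
  lookup-endpoints h v = trans (lookup-· (unit u) (unit u′) v)
    (trans (cong₂ _+_ (lookup-unit u v) (lookup-unit u′ v))
      (trans (lemma (lookup ⁅ u ⁆ v) (lookup ⁅ u′ ⁆ v) disjoint)
        (cong bit (sym (Vec.lookup-zipWith _∨_ v ⁅ u ⁆ ⁅ u′ ⁆)))))
    where
    u u′ : Fin order
    u  = proj₁ (ends h)
    u′ = proj₂ (ends h)
    disjoint : lookup ⁅ u ⁆ v ≡ true → lookup ⁅ u′ ⁆ v ≡ true → ⊥
    disjoint v∈u v∈u′ = Fin.<-irrefl (trans (sym (Subset.x∈⁅y⁆⇒x≡y u (Vec.lookup⇒[]= v _ v∈u)))
                                             (Subset.x∈⁅y⁆⇒x≡y u′ (Vec.lookup⇒[]= v _ v∈u′))) (ends-ordered h)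
    lemma : ∀ b b′ → (b ≡ true → b′ ≡ true → ⊥) → bit b + bit b′ ≡ bit (b ∨ b′)
    lemma false b′    _ = refl
    lemma true  false _ = refl
    lemma true  true  f = contradiction refl (f refl)

  lookup-∂ : ∀ α v → lookup (∂ α) v ≡ degreeAt α v
  lookup-∂ α v = trans (lookup-∏ (λ h → lookup α h ⊙ endpoints h) v) (sum-cong-≗ λ h →
    trans (lookup-⊙ (lookup α h) (endpoints h) v) (cong (lookup α h *_) (lookup-endpoints h v)))

  degree-∂ : ∀ α → degree (∂ α) ≡ degree α + degree α
  degree-∂ α = trans (degree-∏ (λ h → lookup α h ⊙ endpoints h)) (trans (sum-cong-≗ lemma)
    (trans (∑-distrib-+ (lookup α) (lookup α)) (sym (cong₂ _+_ (degree≡∑ α) (degree≡∑ α)))))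
    where
    lemma : ∀ h → degree (lookup α h ⊙ endpoints h) ≡ lookup α h + lookup α h
    lemma h = trans (degree-⊙ (lookup α h) (endpoints h)) (trans
      (cong (lookup α h *_) (trans (degree-· (unit (proj₁ (ends h))) (unit (proj₂ (ends h))))
        (cong₂ _+_ (degree-unit (proj₁ (ends h))) (degree-unit (proj₂ (ends h))))))
      (trans (ℕ.*-comm (lookup α h) 2) (cong (lookup α h +_) (ℕ.+-identityʳ _))))

  ≋⇒∂≃∂ : ∀ α β → α ≋ β → ∂ α ≃ ∂ β
  ≋⇒∂≃∂ α β (deg , par) =
    trans (degree-∂ α) (trans (cong₂ _+_ deg deg) (sym (degree-∂ β))) ,
    λ v → trans (cong parity (lookup-∂ α v)) (trans (par v) (cong parity (sym (lookup-∂ β v))))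

  ∂≃∂⇒≋ : ∀ α β → ∂ α ≃ ∂ β → α ≋ β
  ∂≃∂⇒≋ α β (deg , par) =
    m+m-injective (trans (sym (degree-∂ α)) (trans deg (degree-∂ β))) ,
    λ v → trans (cong parity (sym (lookup-∂ α v))) (trans (par v) (cong parity (lookup-∂ β v)))

  private
    -- Products of variables are single terms, but their coefficient 1# * ⋯ * 1# is only ≈ 1#.
    IsMonomial : Poly n → Monomial n → Set _
    IsMonomial f γ = ∃[ b ] (f ≡ (b , γ) ∷ [] × b K.≈ 1#)

    isMonomial-⊗ : ∀ {f g : Poly n} {γ γ′} → IsMonomial f γ → IsMonomial g γ′ → IsMonomial (f ⊗ g) (γ · γ′)
    isMonomial-⊗ (b , refl , b≈1) (b′ , refl , b′≈1) =
      b K.* b′ , refl , K.trans (K.*-cong b≈1 b′≈1) (K.*-identityˡ 1#)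

    isMonomial-^ : ∀ {f : Poly n} {γ} k → IsMonomial f γ → IsMonomial (f ^ k) (k ⊙ γ)
    isMonomial-^ zero    _  = 1# , refl , K.refl
    isMonomial-^ (suc k) fγ = isMonomial-⊗ fγ (isMonomial-^ k fγ)

    isMonomial-product : ∀ {m} {t : Fin m → Poly n} {γ : Fin m → Monomial n} →
                         (∀ h → IsMonomial (t h) (γ h)) → IsMonomial (product t) (∏ γ)
    isMonomial-product {m = zero}  _  = 1# , refl , K.refl
    isMonomial-product {m = suc m} tγ = isMonomial-⊗ (tγ zero) (isMonomial-product (tγ ∘ suc))

    isMonomial-φ : ∀ α → IsMonomial (product (λ h → (var (proj₁ (ends h)) ⊗ var (proj₂ (ends h))) ^ lookup α h)) (∂ α)
    isMonomial-φ α = isMonomial-product {t = λ h → (var (proj₁ (ends h)) ⊗ var (proj₂ (ends h))) ^ lookup α h}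
      {γ = λ h → lookup α h ⊙ endpoints h}
      λ h → isMonomial-^ (lookup α h) (isMonomial-⊗ {f = var (proj₁ (ends h))} {var (proj₂ (ends h))} (1# , refl , K.refl) (1# , refl , K.refl))

  -- `φ` sends monomials to monomials, so pulling a functional back along it composes the weights
  -- with `∂`.
  extend-φ : ∀ (w : Monomial order → Carrier) f → extend w (φ f) K.≈ extend (w ∘ ∂) f
  extend-φ w []            = K.refl
  extend-φ w ((a , α) ∷ f) with b , eq , b≈1 ← isMonomial-φ α = begin
    extend w (const a ⊗ t ⊕ φ f)                   ≈⟨ extend-⊕ w (const a ⊗ t) (φ f) ⟩
    extend w (const a ⊗ t) K.+ extend w (φ f)      ≈⟨ K.+-cong head (extend-φ w f) ⟩
    a K.* w (∂ α) K.+ extend (w ∘ ∂) f             ∎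
    where
    t : Poly order
    t = product (λ h → (var (proj₁ (ends h)) ⊗ var (proj₂ (ends h))) ^ lookup α h)
    head : extend w (const a ⊗ t) K.≈ a K.* w (∂ α)
    head = begin
      extend w (const a ⊗ t)                         ≡⟨ cong (λ t → extend w (const a ⊗ t)) eq ⟩
      a K.* b K.* w (𝟏 · ∂ α) K.+ 0#                 ≈⟨ K.+-identityʳ _ ⟩
      a K.* b K.* w (𝟏 · ∂ α)                        ≡⟨ cong (λ γ → a K.* b K.* w γ) (·-identityˡ (∂ α)) ⟩
      a K.* b K.* w (∂ α)                            ≈⟨ K.*-congʳ (K.trans (K.*-congˡ b≈1) (K.*-identityʳ a)) ⟩
      a K.* w (∂ α)                                  ∎

  binomial∈EulerianIdeal : ∀ {f} α β → α ≋ β → f ≈ binomial α β → EulerianIdeal f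
  binomial∈EulerianIdeal {f} α β α≋β f≈ =
    respects {f = binomial (∂ α) (∂ β)} {φ f} (≈-by-extend (binomial (∂ α) (∂ β)) (φ f) eq)
      (≃⇒∼ {γ = ∂ α} {∂ β} (≋⇒∂≃∂ α β α≋β))
    where
    eq : ∀ w → extend w (binomial (∂ α) (∂ β)) K.≈ extend w (φ f)
    eq w = begin
      extend w (binomial (∂ α) (∂ β))  ≈⟨ extend-binomial w (∂ α) (∂ β) ⟩
      w (∂ α) K.- w (∂ β)              ≈⟨ extend-binomial (w ∘ ∂) α β ⟨
      extend (w ∘ ∂) (binomial α β)    ≈⟨ extend-≈ (w ∘ ∂) f (binomial α β) f≈ ⟨
      extend (w ∘ ∂) f                 ≈⟨ extend-φ w f ⟨
      extend w (φ f)                   ∎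

  𝓣∪𝓔⊆EulerianIdeal : (𝓣 ∪ 𝓔) ⊆ EulerianIdeal
  𝓣∪𝓔⊆EulerianIdeal {f} (inj₁ (h , l , f≈)) = binomial∈EulerianIdeal {f} (square h) (square l) (square-≋ h l)
    λ m → K.trans (f≈ m) (squareDifference≈binomial h l m)
  𝓣∪𝓔⊆EulerianIdeal {f} (inj₂ (α , β , pair , f≈)) = binomial∈EulerianIdeal {f} α β (eulerianPair⇒≋ pair) f≈

  private
    indicator : ∀ {A : Set} → Dec A → Carrier
    indicator A? = if does A? then 1# else 0#

    indicator-cong : ∀ {A B : Set} (A? : Dec A) (B? : Dec B) → (A → B) → (B → A) → indicator A? K.≈ indicator B?
    indicator-cong (yes _) (yes _) _ _ = K.refl
    indicator-cong (no _)  (no _)  _ _ = K.refl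
    indicator-cong (yes a) (no ¬b) f _ = contradiction (f a) ¬b
    indicator-cong (no ¬a) (yes b) _ g = contradiction (g b) ¬a

    -- The indicator of B ∖ A.
    difference : ∀ {A B : Set} → Dec A → Dec B → Carrier
    difference A? B? = if does A? then 0# else indicator B?

    difference-+ : ∀ {A B : Set} (A? : Dec A) (B? : Dec B) → (A → B) →
                   indicator B? K.≈ indicator A? K.+ difference A? B?
    difference-+ (no _)  B?      _ = K.sym (K.+-identityˡ _)
    difference-+ (yes _) (yes _) _ = K.sym (K.+-identityʳ 1#)
    difference-+ (yes a) (no ¬b) f = contradiction (f a) ¬b

    difference-# : ∀ {A B : Set} (A? : Dec A) (B? : Dec B) → difference A? B? # 0# → ¬ A × B
    difference-# (no ¬a) (yes b) _   = ¬a , b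
    difference-# (no _)  (no _)  0#0 = contradiction 0#0 (#-irrefl K.refl)
    difference-# (yes _) _       0#0 = contradiction 0#0 (#-irrefl K.refl)

  -- The coefficients of f over the class of m sum to 0#, so that of m is not the only nonzero one.
  another-monomial : ∀ {f m} → EulerianIdeal f → coeff f m # 0# →
                     ∃[ m′ ] (m′ ≢ m × m ≋ m′ × coeff f m′ # 0#)
  another-monomial {f} {m} f∈I fm#0 =
    -- The coefficient of `m` is the negative of `extend rest f`, so the latter is apart from 0, and
    -- `extend-#` finds a monomial on which `rest` does not vanish.
    let m′ , fm′#0 , rest#0 = extend-# rest f (xy#0⇒y#0 (#-congʳ fm≈-rest fm#0))
        m′≢m , m≋m′ = rest-# m′ rest#0
    in m′ , m′≢m , m≋m′ , fm′#0
    where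
    class : Monomial order → Carrier
    class γ = indicator (∂ m ≃? γ)

    class-invariant : Invariant class
    class-invariant γ γ′ γ≃γ′ = indicator-cong (∂ m ≃? γ) (∂ m ≃? γ′)
      (λ p → ≃-trans {γ = ∂ m} {γ} {γ′} p γ≃γ′)
      (λ p → ≃-trans {γ = ∂ m} {γ′} {γ} p (≃-sym {γ = γ} {γ′} γ≃γ′))

    rest : Monomial size → Carrier
    rest α = difference (α ≟ᵐ m) (∂ m ≃? ∂ α)

    split : ∀ α → class (∂ α) K.≈ δ m α K.+ rest α
    split α = difference-+ (α ≟ᵐ m) (∂ m ≃? ∂ α) λ { refl → refl , λ _ → refl }

    sum≈0 : coeff f m K.+ extend rest f K.≈ 0#
    sum≈0 = begin
      coeff f m K.+ extend rest f        ≈⟨ K.+-congʳ (coeff≈extend-δ f m) ⟩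
      extend (δ m) f K.+ extend rest f   ≈⟨ extend-+ (δ m) rest f ⟨
      extend (λ α → δ m α K.+ rest α) f  ≈⟨ extend-cong f split ⟨
      extend (class ∘ ∂) f               ≈⟨ extend-φ class f ⟨
      extend class (φ f)                 ≈⟨ extend-⟨squares⟩ {w = class} {φ f} class-invariant f∈I ⟩
      0#                                 ∎

    fm≈-rest : coeff f m K.≈ K.- 1# K.* extend rest f
    fm≈-rest = begin
      coeff f m                                              ≈⟨ K.+-identityʳ _ ⟨
      coeff f m K.+ 0#                                       ≈⟨ K.+-congˡ (K.-‿inverseʳ (extend rest f)) ⟨
      coeff f m K.+ (extend rest f K.- extend rest f)        ≈⟨ K.+-assoc _ _ _ ⟨
      coeff f m K.+ extend rest f K.- extend rest f          ≈⟨ K.+-congʳ sum≈0 ⟩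
      0# K.- extend rest f                                   ≈⟨ K.+-identityˡ _ ⟩
      K.- extend rest f                                      ≈⟨ -1*x≈-x _ ⟨
      K.- 1# K.* extend rest f                               ∎

    rest-# : ∀ α → rest α # 0# → α ≢ m × m ≋ α
    rest-# α p = let α≢m , ∂m≃∂α = difference-# (α ≟ᵐ m) (∂ m ≃? ∂ α) p in α≢m , ∂≃∂⇒≋ m α ∂m≃∂α

  -- Leading monomials of the Eulerian ideal

  module _ (ε : Permutation′ size) where

    grevlex-irrefl : ∀ α β → Grevlex ε β α → α ≢ β
    grevlex-irrefl α .α (inj₁ deg<)                refl = ℕ.<-irrefl refl deg<
    grevlex-irrefl α .α (inj₂ (_ , _ , αk<βk , _)) refl = ℕ.<-irrefl refl αk<βk

    private
      Initial : Pred (Poly size) _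
      Initial = InitialIdeal (Grevlex ε) (𝓣 ∪ 𝓔)

    binomial⇒monomial∈Initial : ∀ f α β m → (𝓣 ∪ 𝓔) f → f ≈ binomial α β → Grevlex ε β α →
                                (∀ h → lookup α h ≤ lookup m h) → Initial (monomial m)
    binomial⇒monomial∈Initial f α β m f∈ f≈ β≺α α≤m = ⟨⟩-monomial-∣ {α = α} {m} α≤m (generator
      (f , α , f∈ , leadingMonomial-binomial {_≺_ = Grevlex ε} {f} {α} {β} (grevlex-irrefl α β β≺α) β≺α f≈ , λ _ → K.refl))

    smaller⇒monomial∈Initial : ∀ m m′ → m ≋ m′ → Grevlex ε m′ m → Initial (monomial m)
    smaller⇒monomial∈Initial m m′ m≋m′ m′≺m =
      let α , β , kind , β≺α , α≤m = reduction ε {m} {m′} m≋m′ m′≺m in conclude α β kind β≺α α≤m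
      where
      conclude : ∀ α β → (∃₂ λ h l → α ≡ square h × β ≡ square l) ⊎ IsEulerianPair α β → Grevlex ε β α →
                 (∀ h → lookup α h ≤ lookup m h) → Initial (monomial m)
      conclude α β (inj₁ (h , l , refl , refl)) = binomial⇒monomial∈Initial (var h ^ 2 ⊖ var l ^ 2) α β m
        (inj₁ (h , l , λ _ → K.refl)) (squareDifference≈binomial h l)
      conclude α β (inj₂ pair) = binomial⇒monomial∈Initial (binomial α β) α β m
        (inj₂ (α , β , pair , λ _ → K.refl)) (λ _ → K.refl)

    -- The second monomial from `another-monomial` occurs in `f`, so it lies below the leading one,
    -- and the pair can be reduced.
    leading∈Initial : ∀ {f m} → EulerianIdeal f → IsLeadingMonomial (Grevlex ε) f m → Initial (monomial m)
    leading∈Initial {f} {m} f∈I (fm#0 , lower) =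
      let m′ , m′≢m , m≋m′ , fm′#0 = another-monomial {f} f∈I fm#0
      in smaller⇒monomial∈Initial m m′ m≋m′ (fromInj₂ (λ m′≡m → contradiction m′≡m m′≢m) (lower m′ fm′#0))

  -- Finiteness of the basis

  isEulerianPair? : ∀ α β → Dec (IsEulerianPair α β)
  isEulerianPair? α β = map′
    (λ (p₁ , p₂ , p₃ , p₄ , p₅ , p₆) → record
      { distinct = p₁ ; relativelyPrime = p₂ ; squareFreeˡ = p₃ ; squareFreeʳ = p₄ ; sameDegree = p₅ ; evenEulerian = p₆ })
    (λ p → let open IsEulerianPair p in distinct , relativelyPrime , squareFreeˡ , squareFreeʳ , sameDegree , evenEulerian)
    (¬? (α ≟ᵐ β) ×-dec
     Fin.all? (λ h → (lookup α h ℕ.≟ 0) ⊎-dec (lookup β h ℕ.≟ 0)) ×-dec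
     Fin.all? (λ h → lookup α h ℕ.≤? 1) ×-dec
     Fin.all? (λ h → lookup β h ℕ.≤? 1) ×-dec
     (degree α ℕ.≟ degree β) ×-dec
     (Fin.all? (λ v → isVertexOf? v →-dec (2 ∣? degreeIn J v)) ×-dec (2 ∣? ∣ J ∣)))
    where
    J : Subset size
    J = oddEdges α ∪ˢ oddEdges β
    isVertexOf? : ∀ v → Dec (IsVertexOf J v)
    isVertexOf? v = Fin.any? (λ h → (h Subset.∈? J) ×-dec (v Subset.∈? edge h))

  private
    squareFreePairs : List (Monomial size × Monomial size)
    squareFreePairs = cartesianProduct (squareFreeMonomials size) (squareFreeMonomials size)

    𝓣-list 𝓔-list : List (Poly size)
    𝓣-list = cartesianProductWith (λ h l → var h ^ 2 ⊖ var l ^ 2) (allFin size) (allFin size)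
    𝓔-list = map (λ (α , β) → binomial α β) (filter (λ (α , β) → isEulerianPair? α β) squareFreePairs)

  𝓣∪𝓔-finite : ∃[ fs ] (∀ f → (𝓣 ∪ 𝓔) f ⇔ Any (f ≈_) fs)
  𝓣∪𝓔-finite = 𝓣-list ++ 𝓔-list , λ f → mk⇔ (to {f}) (from {f})
    where
    to : ∀ {f} → (𝓣 ∪ 𝓔) f → Any (f ≈_) (𝓣-list ++ 𝓔-list)
    to (inj₁ (h , l , f≈)) = lose (∈-++⁺ˡ (∈-cartesianProductWith⁺ _ (∈-allFin h) (∈-allFin l))) f≈
    to (inj₂ (α , β , pair , f≈)) = lose (∈-++⁺ʳ 𝓣-list (∈-map⁺ _ (∈-filter⁺ (λ (α , β) → isEulerianPair? α β)
      (∈-cartesianProduct⁺ (∈-squareFreeMonomials α squareFreeˡ) (∈-squareFreeMonomials β squareFreeʳ)) pair))) f≈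
      where open IsEulerianPair pair
    from-𝓣 : ∀ {f g} → g ∈ 𝓣-list → f ≈ g → 𝓣 f
    from-𝓣 {f} g∈ f≈g =
      let h , l , _ , _ , g≡ = ∈-cartesianProductWith⁻ (λ h l → var h ^ 2 ⊖ var l ^ 2) (allFin size) (allFin size) g∈
      in h , l , subst (f ≈_) g≡ f≈g
    from-𝓔 : ∀ {f g} → g ∈ 𝓔-list → f ≈ g → 𝓔 f
    from-𝓔 {f} g∈ f≈g =
      let (α , β) , αβ∈ , g≡ = ∈-map⁻ (λ (α , β) → binomial α β) g∈
      in α , β , proj₂ (∈-filter⁻ (λ (α , β) → isEulerianPair? α β) {v = α , β} {squareFreePairs} αβ∈) , subst (f ≈_) g≡ f≈g
    from : ∀ {f} → Any (f ≈_) (𝓣-list ++ 𝓔-list) → (𝓣 ∪ 𝓔) f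
    from {f} any = let g , g∈ , f≈g = find any in
      Sum.map (λ g∈𝓣 → from-𝓣 {f} {g} g∈𝓣 f≈g) (λ g∈𝓔 → from-𝓔 {f} {g} g∈𝓔 f≈g) (∈-++⁻ 𝓣-list g∈)

theorem3p3 : ∀ {c ℓ₁ ℓ₂} (K : HeytingField c ℓ₁ ℓ₂) (G : Graph) →
    let open Polynomials K
        open Graph G
        open Eulerian K G
    in NoIsolatedVertices → 1 < size →
    (ε : Permutation′ size) →
    IsGröbnerBasis (Grevlex ε) EulerianIdeal (𝓣 ∪ 𝓔)
theorem3p3 K G _ _ ε = record
  { finite  = 𝓣∪𝓔-finite
  ; subset  = λ {f} → 𝓣∪𝓔⊆EulerianIdeal {f}
  ; initial =
      ⟨⟩-least (λ {g} (f , m , f∈ , lm , g≈) → generator {f = g} (f , m , 𝓣∪𝓔⊆EulerianIdeal {f} f∈ , lm , g≈)) ,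
      -- The inclusion with content: every leading monomial of the ideal is a multiple of one of the
      -- basis.
      ⟨⟩-least (λ {g} (f , m , f∈ , lm , g≈) → respects {f = monomial m} {g} (λ m′ → K.sym (g≈ m′)) (leading∈Initial ε {f} {m} f∈ lm))
  }
  where
  open Polynomials K
  open PolynomialProperties K
  open GröbnerBasis K G
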